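{- Let $a,b$ be positive integers. There exists an Eisenstein lattice equable parallelogram with sides of length $a\sqrt3$ and $b\sqrt3$ if and only if $9a^2b^2-12(a+b)^2$ is a square (of an integer).
   Context: A planar polygon is equable if its perimeter equals its area. The Eisenstein lattice is $\mathbb{Z}[\omega]\subset\mathbb{C}$, where $\omega=-\frac12+i\frac{\sqrt3}{2}$. An Eisenstein lattice equable parallelogram (ELEP) is an equable parallelogram in the plane $\mathbb{C}$ all of whose vertices lie in $\mathbb{Z}[\omega]$. -}

module Defs where

open import Data.Integer.Base as ℤ using (ℤ; +_; +0; +[1+_]; -[1+_])
import Data.Integer.Properties as ℤ
open import Data.Nat.Base as ℕ using (ℕ; zero; suc; _⊔_)
import Data.Nat.Properties as ℕ
open import Data.Nat.Solver using () renaming (module +-*-Solver to ℕ-Solver)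
open import Data.Product.Base using (∃-syntax; _×_; _,_)
open import Data.Rational.Base as ℚ
  using (ℚ; 0ℚ; 1ℚ; ½; ↥_; ↧_; ↧ₙ_; ∣_∣; _+_; _*_; _-_; -_; _≤_; _<_)
import Data.Rational.Properties as ℚ
import Data.Rational.Unnormalised.Base as ℚᵘ
import Data.Rational.Unnormalised.Properties as ℚᵘ
open import Data.Rational.Solver using () renaming (module +-*-Solver to ℚ-Solver)
open import Data.Sum.Base using (inj₁; inj₂)
open import Relation.Binary.PropositionalEquality
open import Relation.Nullary using (¬_; yes; no; contradiction)

abstract
  ∣p∣<ε : ∀ p {ε} → p < ε → - p < ε → ∣ p ∣ < ε
  ∣p∣<ε p p<ε -p<ε with ℚ.∣p∣≡p∨∣p∣≡-p p
  ... | inj₁ eq = subst (_< _) (sym eq) p<ε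
  ... | inj₂ eq = subst (_< _) (sym eq) -p<ε

  p≤∣p∣ : ∀ p → p ≤ ∣ p ∣
  p≤∣p∣ p with ℚ.≤-total 0ℚ p
  ... | inj₁ 0≤p = ℚ.≤-reflexive (sym (ℚ.0≤p⇒∣p∣≡p 0≤p))
  ... | inj₂ p≤0 = ℚ.≤-trans p≤0 (ℚ.0≤∣p∣ p)

  neg-sub : ∀ p q → - (p - q) ≡ q - p
  neg-sub = solve 2 (λ p q → :- (p :- q) := q :- p) refl where open ℚ-Solver

  ∣p-q∣≡∣q-p∣ : ∀ p q → ∣ p - q ∣ ≡ ∣ q - p ∣
  ∣p-q∣≡∣q-p∣ p q = trans (sym (ℚ.∣-p∣≡∣p∣ (p - q))) (cong ∣_∣ (neg-sub p q))

  p-q+q≡p : ∀ p q → (p - q) + q ≡ p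
  p-q+q≡p = solve 2 (λ p q → (p :- q) :+ q := p) refl where open ℚ-Solver

  ½+½ : ∀ p → ½ * p + ½ * p ≡ p
  ½+½ = solve 1 (λ p → con ½ :* p :+ con ½ :* p := p) refl where open ℚ-Solver

  p<q+ε⇒p-q<ε : ∀ {p q ε} → p < q + ε → p - q < ε
  p<q+ε⇒p-q<ε {p} {q} {ε} p<q+ε =
    subst (p - q <_) (lem q ε) (ℚ.+-monoˡ-< (- q) p<q+ε)
    where
    open ℚ-Solver
    lem : ∀ q ε → (q + ε) - q ≡ ε
    lem = solve 2 (λ q ε → (q :+ ε) :- q := ε) refl

  ∣p-q∣<ε⇒p<q+ε : ∀ p q {ε} → ∣ p - q ∣ < ε → p < q + ε
  ∣p-q∣<ε⇒p<q+ε p q {ε} h = subst₂ _<_ (p-q+q≡p p q) (ℚ.+-comm ε q)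
    (ℚ.+-monoˡ-< q (ℚ.≤-<-trans (p≤∣p∣ (p - q)) h))

  ∣p∣-∣q∣≤∣p-q∣ : ∀ p q → ∣ p ∣ - ∣ q ∣ ≤ ∣ p - q ∣
  ∣p∣-∣q∣≤∣p-q∣ p q = subst (∣ p ∣ - ∣ q ∣ ≤_) (lem ∣ p - q ∣ ∣ q ∣)
    (ℚ.+-monoˡ-≤ (- ∣ q ∣)
      (subst (λ r → ∣ r ∣ ≤ ∣ p - q ∣ + ∣ q ∣) (p-q+q≡p p q)
        (ℚ.∣p+q∣≤∣p∣+∣q∣ (p - q) q)))
    where
    open ℚ-Solver
    lem : ∀ r s → (r + s) - s ≡ r
    lem = solve 2 (λ r s → (r :+ s) :- s := r) refl

  *-pos : ∀ {p q} → 0ℚ < p → 0ℚ < q → 0ℚ < p * q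
  *-pos {p} {q} 0<p 0<q = subst (_< p * q) (ℚ.*-zeroʳ p)
    (ℚ.*-monoʳ-<-pos p {{ℚ.positive 0<p}} 0<q)

  *-mono-≤ : ∀ {p q r s} → 0ℚ ≤ q → 0ℚ ≤ r → p ≤ q → r ≤ s → p * r ≤ q * s
  *-mono-≤ {p} {q} {r} {s} 0≤q 0≤r p≤q r≤s = ℚ.≤-trans
    (ℚ.*-monoʳ-≤-nonNeg r {{ℚ.nonNegative 0≤r}} p≤q)
    (ℚ.*-monoˡ-≤-nonNeg q {{ℚ.nonNegative 0≤q}} r≤s)

  half-pos : ∀ {ε} → 0ℚ < ε → 0ℚ < ½ * ε
  half-pos = *-pos (ℚ.positive⁻¹ ½)

toℚ : ℤ → ℚ
toℚ i = i ℚ./ 1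

abstract
  toℚᵘ-toℚ : ∀ i → ℚ.toℚᵘ (toℚ i) ℚᵘ.≃ (i ℚᵘ./ 1)
  toℚᵘ-toℚ i = ℚ.toℚᵘ-fromℚᵘ (i ℚᵘ./ 1)

  toℚ-* : ∀ i j → toℚ i * toℚ j ≡ toℚ (i ℤ.* j)
  toℚ-* i j = ℚ.toℚᵘ-injective
    (ℚᵘ.≃-trans (ℚ.toℚᵘ-homo-* (toℚ i) (toℚ j))
    (ℚᵘ.≃-trans (ℚᵘ.*-cong (toℚᵘ-toℚ i) (toℚᵘ-toℚ j))
    (ℚᵘ.≃-sym (toℚᵘ-toℚ (i ℤ.* j)))))

  toℚ-mono-≤ : ∀ {i j} → i ℤ.≤ j → toℚ i ≤ toℚ j
  toℚ-mono-≤ {i} {j} i≤j = ℚ.toℚᵘ-cancel-≤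
    (ℚᵘ.≤-respʳ-≃ (ℚᵘ.≃-sym (toℚᵘ-toℚ j))
    (ℚᵘ.≤-respˡ-≃ (ℚᵘ.≃-sym (toℚᵘ-toℚ i))
    (ℚᵘ.*≤* (ℤ.*-monoʳ-≤-nonNeg (+ 1) i≤j))))

  toℚ-mono-< : ∀ {i j} → i ℤ.< j → toℚ i < toℚ j
  toℚ-mono-< {i} {j} i<j = ℚ.toℚᵘ-cancel-<
    (ℚᵘ.<-respʳ-≃ (ℚᵘ.≃-sym (toℚᵘ-toℚ j))
    (ℚᵘ.<-respˡ-≃ (ℚᵘ.≃-sym (toℚᵘ-toℚ i))
    (ℚᵘ.*<* (ℤ.*-monoʳ-<-pos (+ 1) i<j))))

  toℚ-+ : ∀ i j → toℚ i + toℚ j ≡ toℚ (i ℤ.+ j)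
  toℚ-+ i j = ℚ.toℚᵘ-injective
    (ℚᵘ.≃-trans (ℚ.toℚᵘ-homo-+ (toℚ i) (toℚ j))
    (ℚᵘ.≃-trans (ℚᵘ.+-cong (toℚᵘ-toℚ i) (toℚᵘ-toℚ j))
    (ℚᵘ.≃-trans (ℚᵘ.*≡* (cong (ℤ._* + 1)
       (cong₂ ℤ._+_ (ℤ.*-identityʳ i) (ℤ.*-identityʳ j))))
    (ℚᵘ.≃-sym (toℚᵘ-toℚ (i ℤ.+ j))))))

  /-*-toℚ : ∀ i n .{{_ : ℕ.NonZero n}} → (i ℚ./ n) * toℚ (+ n) ≡ toℚ i
  /-*-toℚ i n@(suc n-1) = ℚ.toℚᵘ-injective
    (ℚᵘ.≃-trans (ℚ.toℚᵘ-homo-* (i ℚ./ n) (toℚ (+ n)))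
    (ℚᵘ.≃-trans (ℚᵘ.*-cong (ℚ.toℚᵘ-fromℚᵘ (i ℚᵘ./ n)) (toℚᵘ-toℚ (+ n)))
    (ℚᵘ.≃-trans (ℚᵘ.*≡* (trans (ℤ.*-identityʳ _)
        (cong (λ k → i ℤ.* + k) (sym (ℕ.*-identityʳ n)))))
    (ℚᵘ.≃-sym (toℚᵘ-toℚ i)))))

  toℚ-pos : ∀ n .{{_ : ℕ.NonZero n}} → ℚ.Positive (toℚ (+ n))
  toℚ-pos n@(suc _) = ℚ.positive (toℚ-mono-< {+ 0} {+ n} (ℤ.+<+ (ℕ.s≤s ℕ.z≤n)))

  toℚ-nonNeg : ∀ n → 0ℚ ≤ toℚ (+ n)
  toℚ-nonNeg n = toℚ-mono-≤ {+ 0} {+ n} (ℤ.+≤+ ℕ.z≤n)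

  1/-anti : ∀ m n .{{_ : ℕ.NonZero m}} .{{_ : ℕ.NonZero n}} →
            m ℕ.≤ n → (+ 1) ℚ./ n ≤ (+ 1) ℚ./ m
  1/-anti m@(suc _) n@(suc _) m≤n = ℚ.toℚᵘ-cancel-≤
    (ℚᵘ.≤-respʳ-≃ (ℚᵘ.≃-sym (ℚ.toℚᵘ-fromℚᵘ ((+ 1) ℚᵘ./ m)))
    (ℚᵘ.≤-respˡ-≃ (ℚᵘ.≃-sym (ℚ.toℚᵘ-fromℚᵘ ((+ 1) ℚᵘ./ n)))
    (ℚᵘ.*≤* (ℤ.*-monoˡ-≤-nonNeg (+ 1) (ℤ.+≤+ m≤n)))))

  archimedean : ∀ {ε} → 0ℚ < ε → (+ 1) ℚ./ (↧ₙ ε) ≤ ε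
  archimedean {ε@(ℚ.mkℚ (+ 0) d _)} 0<ε = contradiction (ℚ.drop-*<* 0<ε) (ℤ.<-irrefl refl)
  archimedean {ε@(ℚ.mkℚ +[1+ n ] d _)} 0<ε = ℚ.toℚᵘ-cancel-≤
    (ℚᵘ.≤-respˡ-≃ (ℚᵘ.≃-sym (ℚ.toℚᵘ-fromℚᵘ ((+ 1) ℚᵘ./ suc d)))
    (ℚᵘ.*≤* (ℤ.*-monoʳ-≤-nonNeg (+ suc d) {+ 1} {+[1+ n ]} (ℤ.+≤+ (ℕ.s≤s ℕ.z≤n)))))
  archimedean {ε@(ℚ.mkℚ -[1+ n ] d _)} 0<ε = contradiction (ℚ.drop-*<* 0<ε) λ ()

IsCauchy : (ℕ → ℚ) → Set
IsCauchy x = ∀ ε → 0ℚ < ε →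
  ∃[ N ] (∀ m n → N ℕ.≤ m → N ℕ.≤ n → ∣ x m - x n ∣ < ε)

record ℝ : Set where
  constructor mkℝ
  field
    seq      : ℕ → ℚ
    isCauchy : IsCauchy seq

open ℝ public

infix 4 _≃_

_≃_ : ℝ → ℝ → Set
x ≃ y = ∀ ε → 0ℚ < ε → ∃[ N ] (∀ n → N ℕ.≤ n → ∣ seq x n - seq y n ∣ < ε)

fromℚ : ℚ → ℝ
fromℚ q = mkℝ (λ _ → q) λ ε 0<ε →
  0 , λ _ _ _ _ → subst (_< ε) (sym (cong ∣_∣ (ℚ.+-inverseʳ q))) 0<ε

fromℤ : ℤ → ℝ
fromℤ i = fromℚ (i ℚ./ 1)

0ℝ : ℝ
0ℝ = fromℚ 0ℚ

abstract
  +-isCauchy : ∀ {x y} → IsCauchy x → IsCauchy y → IsCauchy (λ n → x n + y n)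
  +-isCauchy {x} {y} x-cauchy y-cauchy ε 0<ε =
    let M , f = x-cauchy (½ * ε) (half-pos 0<ε)
        N , g = y-cauchy (½ * ε) (half-pos 0<ε)
    in M ⊔ N , λ m n h k →
      subst₂ _<_ (cong ∣_∣ (sym (lem (x m) (y m) (x n) (y n)))) (½+½ ε)
        (ℚ.≤-<-trans (ℚ.∣p+q∣≤∣p∣+∣q∣ (x m - x n) (y m - y n))
          (ℚ.+-mono-< (f m n (ℕ.m⊔n≤o⇒m≤o M N h) (ℕ.m⊔n≤o⇒m≤o M N k))
                      (g m n (ℕ.m⊔n≤o⇒n≤o M N h) (ℕ.m⊔n≤o⇒n≤o M N k))))
    where
    open ℚ-Solver
    lem : ∀ p q r s → (p + q) - (r + s) ≡ (p - r) + (q - s)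
    lem = solve 4 (λ p q r s → (p :+ q) :- (r :+ s) := (p :- r) :+ (q :- s)) refl

  neg-isCauchy : ∀ {x} → IsCauchy x → IsCauchy (λ n → - x n)
  neg-isCauchy {x} x-cauchy ε 0<ε =
    let N , f = x-cauchy ε 0<ε
    in N , λ m n h k → subst (_< ε)
      (trans (∣p-q∣≡∣q-p∣ (x m) (x n)) (cong ∣_∣ (lem (x m) (x n))))
      (f m n h k)
    where
    open ℚ-Solver
    lem : ∀ p q → q - p ≡ - p - - q
    lem = solve 2 (λ p q → q :- p := :- p :- :- q) refl

  bounded : ∀ {x} → IsCauchy x → ∃[ B ] 0ℚ < B × ∃[ N ] (∀ n → N ℕ.≤ n → ∣ x n ∣ ≤ B)
  bounded {x} x-cauchy =
    let N , f = x-cauchy 1ℚ (ℚ.positive⁻¹ 1ℚ)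
    in ∣ x N ∣ + 1ℚ
    , ℚ.+-mono-≤-< (ℚ.0≤∣p∣ (x N)) (ℚ.positive⁻¹ 1ℚ)
    , N , λ n h → ℚ.<⇒≤ (∣p-q∣<ε⇒p<q+ε ∣ x n ∣ ∣ x N ∣
        (∣p∣<ε (∣ x n ∣ - ∣ x N ∣)
          (ℚ.≤-<-trans (∣p∣-∣q∣≤∣p-q∣ (x n) (x N)) (f n N h ℕ.≤-refl))
          (subst (_< 1ℚ) (sym (neg-sub ∣ x n ∣ ∣ x N ∣))
            (ℚ.≤-<-trans (∣p∣-∣q∣≤∣p-q∣ (x N) (x n)) (f N n ℕ.≤-refl h)))))

  scale : ∀ {B ε} → 0ℚ < B → 0ℚ < ε → ∃[ δ ] 0ℚ < δ × B * δ ≡ ½ * ε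
  scale {B} {ε} 0<B 0<ε = ℚ.1/ B * (½ * ε)
    , *-pos (ℚ.positive⁻¹ (ℚ.1/ B) {{ℚ.1/pos⇒pos B}}) (half-pos 0<ε)
    , trans (sym (ℚ.*-assoc B (ℚ.1/ B) (½ * ε)))
        (trans (cong (_* (½ * ε)) (ℚ.*-inverseʳ B)) (ℚ.*-identityˡ (½ * ε)))
    where
    instance
      B-pos : ℚ.Positive B
      B-pos = ℚ.positive 0<B
      B-nonZero : ℚ.NonZero B
      B-nonZero = ℚ.pos⇒nonZero B

  *-close : ∀ {B C δ η ε} p q r s → 0ℚ < B → 0ℚ < C → ∣ p ∣ ≤ B → ∣ s ∣ ≤ C →
            ∣ q - s ∣ < δ → ∣ p - r ∣ < η → B * δ ≡ ½ * ε → C * η ≡ ½ * ε →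
            ∣ p * q - r * s ∣ < ε
  *-close {B} {C} {δ} {η} {ε} p q r s 0<B 0<C p≤B s≤C q-s<δ p-r<η Bδ Cη =
    subst₂ _<_ (cong ∣_∣ (sym (lem p q r s))) (trans (cong₂ _+_ Bδ Cη) (½+½ ε))
      (ℚ.≤-<-trans (ℚ.∣p+q∣≤∣p∣+∣q∣ (p * (q - s)) (s * (p - r)))
        (ℚ.+-mono-< (bound p (q - s) 0<B p≤B q-s<δ) (bound s (p - r) 0<C s≤C p-r<η)))
    where
    lem : ∀ p q r s → p * q - r * s ≡ p * (q - s) + s * (p - r)
    lem = solve 4 (λ p q r s → p :* q :- r :* s := p :* (q :- s) :+ s :* (p :- r)) refl
      where open ℚ-Solver

    bound : ∀ {B δ} p q → 0ℚ < B → ∣ p ∣ ≤ B → ∣ q ∣ < δ → ∣ p * q ∣ < B * δ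
    bound {B} {δ} p q 0<B p≤B q<δ = subst (_< B * δ) (sym (ℚ.∣p*q∣≡∣p∣*∣q∣ p q))
      (ℚ.≤-<-trans (ℚ.*-monoʳ-≤-nonNeg ∣ q ∣ {{ℚ.∣-∣-nonNeg q}} p≤B)
        (ℚ.*-monoʳ-<-pos B {{ℚ.positive 0<B}} q<δ))

  *-isCauchy : ∀ {x y} → IsCauchy x → IsCauchy y → IsCauchy (λ n → x n * y n)
  *-isCauchy {x} {y} x-cauchy y-cauchy ε 0<ε =
    let B , 0<B , K , f = bounded {x} x-cauchy
        C , 0<C , L , g = bounded {y} y-cauchy
        δ , 0<δ , Bδ    = scale {B} {ε} 0<B 0<ε
        η , 0<η , Cη    = scale {C} {ε} 0<C 0<ε
        M , f′          = y-cauchy δ 0<δ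
        N , g′          = x-cauchy η 0<η
    in (K ⊔ L) ⊔ (M ⊔ N) , λ m n h k →
      let h₁ = ℕ.m⊔n≤o⇒m≤o (K ⊔ L) (M ⊔ N) h
          h₂ = ℕ.m⊔n≤o⇒n≤o (K ⊔ L) (M ⊔ N) h
          k₁ = ℕ.m⊔n≤o⇒m≤o (K ⊔ L) (M ⊔ N) k
          k₂ = ℕ.m⊔n≤o⇒n≤o (K ⊔ L) (M ⊔ N) k
      in *-close {B} {C} {δ} {η} {ε} (x m) (y m) (x n) (y n) 0<B 0<C
           (f m (ℕ.m⊔n≤o⇒m≤o K L h₁)) (g n (ℕ.m⊔n≤o⇒n≤o K L k₁))
           (f′ m n (ℕ.m⊔n≤o⇒m≤o M N h₂) (ℕ.m⊔n≤o⇒m≤o M N k₂))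
           (g′ m n (ℕ.m⊔n≤o⇒n≤o M N h₂) (ℕ.m⊔n≤o⇒n≤o M N k₂))
           Bδ Cη

  ∣-∣-isCauchy : ∀ {x} → IsCauchy x → IsCauchy (λ n → ∣ x n ∣)
  ∣-∣-isCauchy {x} x-cauchy ε 0<ε =
    let N , f = x-cauchy ε 0<ε
    in N , λ m n h k → ∣p∣<ε (∣ x m ∣ - ∣ x n ∣)
      (ℚ.≤-<-trans (∣p∣-∣q∣≤∣p-q∣ (x m) (x n)) (f m n h k))
      (subst (_< ε) (sym (neg-sub ∣ x m ∣ ∣ x n ∣))
        (ℚ.≤-<-trans (∣p∣-∣q∣≤∣p-q∣ (x n) (x m)) (f n m k h)))

infixl 6 _+ᴿ_ _-ᴿ_
infixl 7 _*ᴿ_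
infix  8 -ᴿ_

_+ᴿ_ _*ᴿ_ : ℝ → ℝ → ℝ
mkℝ x x-cauchy +ᴿ mkℝ y y-cauchy = mkℝ (λ n → x n + y n) (+-isCauchy {x} {y} x-cauchy y-cauchy)
mkℝ x x-cauchy *ᴿ mkℝ y y-cauchy = mkℝ (λ n → x n * y n) (*-isCauchy {x} {y} x-cauchy y-cauchy)

-ᴿ_ : ℝ → ℝ
-ᴿ mkℝ x x-cauchy = mkℝ (λ n → - x n) (neg-isCauchy {x} x-cauchy)

∣_∣ᴿ : ℝ → ℝ
∣ mkℝ x x-cauchy ∣ᴿ = mkℝ (λ n → ∣ x n ∣) (∣-∣-isCauchy {x} x-cauchy)

_-ᴿ_ : ℝ → ℝ → ℝ
x -ᴿ y = x +ᴿ (-ᴿ y)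

-- The largest r with r * r ≤ n.
⌊√_⌋ : ℕ → ℕ
⌊√ zero ⌋ = 0
⌊√ suc n ⌋ with suc ⌊√ n ⌋ ℕ.* suc ⌊√ n ⌋ ℕ.≤? suc n
... | yes _ = suc ⌊√ n ⌋
... | no  _ = ⌊√ n ⌋

⌊√⌋-lower : ∀ n → ⌊√ n ⌋ ℕ.* ⌊√ n ⌋ ℕ.≤ n
⌊√⌋-lower zero = ℕ.z≤n
⌊√⌋-lower (suc n) with suc ⌊√ n ⌋ ℕ.* suc ⌊√ n ⌋ ℕ.≤? suc n
... | yes p = p
... | no  _ = ℕ.m≤n⇒m≤1+n (⌊√⌋-lower n)

⌊√⌋-upper : ∀ n → n ℕ.< suc ⌊√ n ⌋ ℕ.* suc ⌊√ n ⌋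
⌊√⌋-upper zero = ℕ.s≤s ℕ.z≤n
⌊√⌋-upper (suc n) with suc ⌊√ n ⌋ ℕ.* suc ⌊√ n ⌋ ℕ.≤? suc n
... | yes _ = ℕ.≤-<-trans (⌊√⌋-upper n)
        (ℕ.*-mono-< (ℕ.n<1+n (suc ⌊√ n ⌋)) (ℕ.n<1+n (suc ⌊√ n ⌋)))
... | no ¬p = ℕ.≰⇒> ¬p

-- Negative numbers are sent to 0 by the square root.
_⁺ : ℚ → ℚ
x ⁺ = x ℚ.⊔ 0ℚ

-- √-approx approximates √(p / q) = √(p q) / q from below to within 1 / (n + 1).
√-radicand : ℚ → ℕ → ℕ
√-radicand x n = ℤ.∣ ↥ (x ⁺) ∣ ℕ.* ↧ₙ (x ⁺) ℕ.* (suc n ℕ.* suc n)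

√-approx : ℚ → ℕ → ℚ
√-approx x n = (+ ⌊√ √-radicand x n ⌋) ℚ./ (↧ₙ (x ⁺) ℕ.* suc n)

abstract
  0≤x⁺ : ∀ x → 0ℚ ≤ x ⁺
  0≤x⁺ x = ℚ.p≤q⊔p x 0ℚ

  0≤i/n : ∀ i n .{{_ : ℕ.NonZero n}} → 0ℚ ≤ (+ i) ℚ./ n
  0≤i/n i n = ℚ.*-cancelʳ-≤-pos (toℚ (+ n)) {{toℚ-pos n}}
    (subst₂ _≤_ (sym (ℚ.*-zeroˡ (toℚ (+ n)))) (sym (/-*-toℚ (+ i) n)) (toℚ-nonNeg i))

  toℚ-*ℕ : ∀ m n → toℚ (+ m) * toℚ (+ n) ≡ toℚ (+ (m ℕ.* n))
  toℚ-*ℕ m n = trans (toℚ-* (+ m) (+ n)) (cong toℚ (sym (ℤ.pos-* m n)))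

  module Fraction (y : ℚ) (K j D : ℕ) .{{_ : ℕ.NonZero D}}
                  (yD² : y * (toℚ (+ D) * toℚ (+ D)) ≡ toℚ (+ K)) where

    d s t : ℚ
    d = toℚ (+ D)
    s = (+ j) ℚ./ D
    t = (+ 1) ℚ./ D

    instance
      d-pos : ℚ.Positive d
      d-pos = toℚ-pos D
      d²-pos : ℚ.Positive (d * d)
      d²-pos = ℚ.pos*pos⇒pos d d
      d²-nonNeg : ℚ.NonNegative (d * d)
      d²-nonNeg = ℚ.pos⇒nonNeg (d * d)

    square : ∀ r d → (r * r) * (d * d) ≡ (r * d) * (r * d)
    square = solve 2 (λ r d → (r :* r) :* (d :* d) := (r :* d) :* (r :* d)) refl
      where open ℚ-Solver

    sd : s * d ≡ toℚ (+ j)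
    sd = /-*-toℚ (+ j) D

    [s+t]d : (s + t) * d ≡ toℚ (+ suc j)
    [s+t]d = trans (ℚ.*-distribʳ-+ d s t)
      (trans (cong₂ _+_ sd (/-*-toℚ (+ 1) D))
        (trans (toℚ-+ (+ j) (+ 1)) (cong (λ k → toℚ (+ k)) (ℕ.+-comm j 1))))

    lower : j ℕ.* j ℕ.≤ K → s * s ≤ y
    lower j²≤K = ℚ.*-cancelʳ-≤-pos (d * d)
      (subst₂ _≤_ (sym (trans (square s d) (trans (cong₂ _*_ sd sd) (toℚ-*ℕ j j))))
        (sym yD²) (toℚ-mono-≤ (ℤ.+≤+ j²≤K)))

    upper : K ℕ.< suc j ℕ.* suc j → y < (s + t) * (s + t)
    upper K<[1+j]² = ℚ.*-cancelʳ-<-nonNeg (d * d)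
      (subst₂ _<_ (sym yD²)
        (sym (trans (square (s + t) d)
          (trans (cong₂ _*_ [s+t]d [s+t]d) (toℚ-*ℕ (suc j) (suc j)))))
        (toℚ-mono-< (ℤ.+<+ K<[1+j]²)))

  clear-denominators : ∀ y → 0ℚ ≤ y → ∀ M → let p = ℤ.∣ ↥ y ∣ ; q = ↧ₙ y in
    y * (toℚ (+ (q ℕ.* M)) * toℚ (+ (q ℕ.* M))) ≡ toℚ (+ (p ℕ.* q ℕ.* (M ℕ.* M)))
  clear-denominators y 0≤y M = lem ℤ.∣ ↥ y ∣ (↧ₙ y)
    (trans (cong (_* toℚ (+ ↧ₙ y)) (sym (ℚ.↥p/↧p≡p y)))
      (trans (/-*-toℚ (↥ y) (↧ₙ y)) (cong toℚ (numerator y (ℚ.nonNegative 0≤y)))))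
    where
    numerator : ∀ z → ℚ.NonNegative z → ↥ z ≡ + ℤ.∣ ↥ z ∣
    numerator (ℚ.mkℚ (+ _) _ _) _ = refl

    rearrange : ∀ q M → q ℕ.* M ℕ.* (q ℕ.* M) ≡ q ℕ.* (q ℕ.* (M ℕ.* M))
    rearrange = solve 2 (λ q M → q :* M :* (q :* M) := q :* (q :* (M :* M))) refl
      where open ℕ-Solver

    lem : ∀ p q → y * toℚ (+ q) ≡ toℚ (+ p) →
      y * (toℚ (+ (q ℕ.* M)) * toℚ (+ (q ℕ.* M))) ≡ toℚ (+ (p ℕ.* q ℕ.* (M ℕ.* M)))
    lem p q yq = begin
      y * (toℚ (+ (q ℕ.* M)) * toℚ (+ (q ℕ.* M))) ≡⟨ cong (y *_) (toℚ-*ℕ (q ℕ.* M) (q ℕ.* M)) ⟩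
      y * toℚ (+ (q ℕ.* M ℕ.* (q ℕ.* M)))         ≡⟨ cong (λ k → y * toℚ (+ k)) (rearrange q M) ⟩
      y * toℚ (+ (q ℕ.* (q ℕ.* (M ℕ.* M))))       ≡⟨ cong (y *_) (toℚ-*ℕ q (q ℕ.* (M ℕ.* M))) ⟨
      y * (toℚ (+ q) * toℚ (+ (q ℕ.* (M ℕ.* M)))) ≡⟨ ℚ.*-assoc y (toℚ (+ q)) (toℚ (+ (q ℕ.* (M ℕ.* M)))) ⟨
      y * toℚ (+ q) * toℚ (+ (q ℕ.* (M ℕ.* M)))   ≡⟨ cong (_* toℚ (+ (q ℕ.* (M ℕ.* M)))) yq ⟩
      toℚ (+ p) * toℚ (+ (q ℕ.* (M ℕ.* M)))       ≡⟨ toℚ-*ℕ p (q ℕ.* (M ℕ.* M)) ⟩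
      toℚ (+ (p ℕ.* (q ℕ.* (M ℕ.* M))))           ≡⟨ cong (λ k → toℚ (+ k)) (ℕ.*-assoc p q (M ℕ.* M)) ⟨
      toℚ (+ (p ℕ.* q ℕ.* (M ℕ.* M)))             ∎
      where open ≡-Reasoning

  √-approx-nonNeg : ∀ x n → 0ℚ ≤ √-approx x n
  √-approx-nonNeg x n = 0≤i/n ⌊√ √-radicand x n ⌋ (↧ₙ (x ⁺) ℕ.* suc n)

  √-approx-lower : ∀ x n → √-approx x n * √-approx x n ≤ x ⁺
  √-approx-lower x n =
    Fraction.lower (x ⁺) (√-radicand x n) ⌊√ √-radicand x n ⌋ (↧ₙ (x ⁺) ℕ.* suc n)
      (clear-denominators (x ⁺) (0≤x⁺ x) (suc n)) (⌊√⌋-lower (√-radicand x n))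

  widen : ∀ y s t u → 0ℚ ≤ s → 0ℚ ≤ t → t ≤ u → y < (s + t) * (s + t) → y < (s + u) * (s + u)
  widen y s t u 0≤s 0≤t t≤u y<[s+t]² = ℚ.<-≤-trans y<[s+t]²
    (*-mono-≤ (ℚ.≤-trans 0≤s+t s+t≤s+u) 0≤s+t s+t≤s+u s+t≤s+u)
    where
    0≤s+t : 0ℚ ≤ s + t
    0≤s+t = ℚ.+-mono-≤ 0≤s 0≤t
    s+t≤s+u : s + t ≤ s + u
    s+t≤s+u = ℚ.+-monoʳ-≤ s t≤u

  √-approx-upper : ∀ x n → let u = √-approx x n + (+ 1) ℚ./ suc n in x ⁺ < u * u
  √-approx-upper x n =
    widen (x ⁺) (√-approx x n) ((+ 1) ℚ./ (↧ₙ (x ⁺) ℕ.* suc n)) ((+ 1) ℚ./ suc n)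
      (√-approx-nonNeg x n) (0≤i/n 1 (↧ₙ (x ⁺) ℕ.* suc n))
      (1/-anti (suc n) (↧ₙ (x ⁺) ℕ.* suc n) (ℕ.m≤n*m (suc n) (↧ₙ (x ⁺))))
      (Fraction.upper (x ⁺) (√-radicand x n) ⌊√ √-radicand x n ⌋ (↧ₙ (x ⁺) ℕ.* suc n)
        (clear-denominators (x ⁺) (0≤x⁺ x) (suc n)) (⌊√⌋-upper (√-radicand x n)))

abstract
  ⁺-close : ∀ x y {ε} → 0ℚ < ε → ∣ x - y ∣ < ε → x ⁺ ≤ y ⁺ + ε
  ⁺-close x y {ε} 0<ε x-y<ε = ℚ.⊔-lub
    (ℚ.≤-trans (ℚ.<⇒≤ (∣p-q∣<ε⇒p<q+ε x y x-y<ε)) (ℚ.+-monoˡ-≤ ε (ℚ.p≤p⊔q y 0ℚ)))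
    (ℚ.+-mono-≤ (0≤x⁺ y) (ℚ.<⇒≤ 0<ε))

  square-gap : ∀ {a b s u h} → 0ℚ ≤ u → 0ℚ ≤ h →
               s * s ≤ a → b < u * u → a ≤ b + h * h → s < u + h
  square-gap {a} {b} {s} {u} {h} 0≤u 0≤h s²≤a b<u² a≤b+h² = ℚ.≰⇒> λ u+h≤s →
    ℚ.<-irrefl refl (ℚ.<-≤-trans (ℚ.≤-<-trans (chain₁ u+h≤s) chain₂) chain₃)
    where
    0≤u+h : 0ℚ ≤ u + h
    0≤u+h = ℚ.+-mono-≤ 0≤u 0≤h

    chain₁ : u + h ≤ s → (u + h) * (u + h) ≤ b + h * h
    chain₁ u+h≤s = ℚ.≤-trans (*-mono-≤ (ℚ.≤-trans 0≤u+h u+h≤s) 0≤u+h u+h≤s u+h≤s)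
      (ℚ.≤-trans s²≤a a≤b+h²)

    chain₂ : b + h * h < u * u + h * h
    chain₂ = ℚ.+-monoˡ-< (h * h) b<u²

    expand : ∀ u h → u * u + h * h + (u * h + u * h) ≡ (u + h) * (u + h)
    expand = solve 2 (λ u h → u :* u :+ h :* h :+ (u :* h :+ u :* h) := (u :+ h) :* (u :+ h)) refl
      where open ℚ-Solver

    0≤uh : 0ℚ ≤ u * h
    0≤uh = subst (_≤ u * h) (ℚ.*-zeroʳ 0ℚ) (*-mono-≤ 0≤u ℚ.≤-refl 0≤u 0≤h)

    chain₃ : u * u + h * h ≤ (u + h) * (u + h)
    chain₃ = subst₂ _≤_ (ℚ.+-identityʳ (u * u + h * h)) (expand u h)
      (ℚ.+-monoʳ-≤ (u * u + h * h) (ℚ.+-mono-≤ 0≤uh 0≤uh))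

  √-close : ∀ x y m n h → 0ℚ < h → (+ 1) ℚ./ suc n ≤ h → ∣ x - y ∣ < h * h →
            √-approx x m < √-approx y n + (h + h)
  √-close x y m n h 0<h 1/n≤h x-y<h² =
    lem (√-approx x m) (√-approx y n) ((+ 1) ℚ./ suc n) 1/n≤h
      (square-gap (ℚ.+-mono-≤ (√-approx-nonNeg y n) (0≤i/n 1 (suc n))) (ℚ.<⇒≤ 0<h)
        (√-approx-lower x m) (√-approx-upper y n)
        (⁺-close x y (*-pos 0<h 0<h) x-y<h²))
    where
    lem : ∀ s r t → t ≤ h → s < (r + t) + h → s < r + (h + h)
    lem s r t t≤h s<r+t+h = ℚ.<-≤-trans s<r+t+h
      (ℚ.≤-trans (ℚ.≤-reflexive (ℚ.+-assoc r t h)) (ℚ.+-monoʳ-≤ r (ℚ.+-monoˡ-≤ h t≤h)))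

  eventually-small : ∀ {ε} → 0ℚ < ε → ∃[ N ] (∀ n → N ℕ.≤ n → (+ 1) ℚ./ suc n ≤ ε)
  eventually-small {ε} 0<ε = ↧ₙ ε , λ n N≤n →
    ℚ.≤-trans (1/-anti (↧ₙ ε) (suc n) (ℕ.m≤n⇒m≤1+n N≤n)) (archimedean 0<ε)

  √-isCauchy : ∀ {x} → IsCauchy x → IsCauchy (λ n → √-approx (x n) n)
  √-isCauchy {x} x-cauchy ε 0<ε =
    let h         = ½ * ε
        0<h       = half-pos 0<ε
        N , f     = x-cauchy (h * h) (*-pos 0<h 0<h)
        K , small = eventually-small 0<h
    in N ⊔ K , λ m n M≤m M≤n →
      let N≤m = ℕ.m⊔n≤o⇒m≤o N K M≤m
          N≤n = ℕ.m⊔n≤o⇒m≤o N K M≤n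
      in both (√-approx (x m) m) (√-approx (x n) n)
        (√-close (x m) (x n) m n h 0<h (small n (ℕ.m⊔n≤o⇒n≤o N K M≤n)) (f m n N≤m N≤n))
        (√-close (x n) (x m) n m h 0<h (small m (ℕ.m⊔n≤o⇒n≤o N K M≤m)) (f n m N≤n N≤m))
    where
    one : ∀ s r → s < r + (½ * ε + ½ * ε) → s - r < ε
    one s r s<r+ε = p<q+ε⇒p-q<ε {s} {r} {ε} (subst (λ δ → s < r + δ) (½+½ ε) s<r+ε)

    both : ∀ s r → s < r + (½ * ε + ½ * ε) → r < s + (½ * ε + ½ * ε) → ∣ s - r ∣ < ε
    both s r s<r+ε r<s+ε =
      ∣p∣<ε (s - r) (one s r s<r+ε) (subst (_< ε) (sym (neg-sub s r)) (one r s r<s+ε))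

√_ : ℝ → ℝ
√ mkℝ x x-cauchy = mkℝ (λ n → √-approx (x n) n) (√-isCauchy {x} x-cauchy)

√3 : ℝ
√3 = √ fromℤ (+ 3)

infix  5 _+i_
infix  4 _≃ᶜ_
infixl 6 _+ᶜ_ _-ᶜ_
infixl 7 _*ᶜ_

record ℂ : Set where
  constructor _+i_
  field
    re im : ℝ

open ℂ public

_≃ᶜ_ : ℂ → ℂ → Set
z ≃ᶜ w = re z ≃ re w × im z ≃ im w

_+ᶜ_ _-ᶜ_ _*ᶜ_ : ℂ → ℂ → ℂ
z +ᶜ w = re z +ᴿ re w +i im z +ᴿ im w
z -ᶜ w = re z -ᴿ re w +i im z -ᴿ im w
z *ᶜ w = re z *ᴿ re w -ᴿ im z *ᴿ im w +i re z *ᴿ im w +ᴿ im z *ᴿ re w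

fromℤᶜ : ℤ → ℂ
fromℤᶜ i = fromℤ i +i 0ℝ

ω : ℂ
ω = fromℚ ℚ.-½ +i fromℚ ½ *ᴿ √3

_∈ℤ[ω] : ℂ → Set
z ∈ℤ[ω] = ∃[ m ] ∃[ n ] (z ≃ᶜ fromℤᶜ m +ᶜ fromℤᶜ n *ᶜ ω)

∣_∣ᶜ : ℂ → ℝ
∣ z ∣ᶜ = √ (re z *ᴿ re z +ᴿ im z *ᴿ im z)

dist : ℂ → ℂ → ℝ
dist z w = ∣ w -ᶜ z ∣ᶜ

det : ℂ → ℂ → ℝ
det z w = re z *ᴿ im w -ᴿ im z *ᴿ re w

record Parallelogram : Set where
  field
    A B C D       : ℂ
    AB≃DC         : B -ᶜ A ≃ᶜ C -ᶜ D
    nondegenerate : ¬ (det (B -ᶜ A) (D -ᶜ A) ≃ 0ℝ)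

module _ (P : Parallelogram) where
  open Parallelogram P

  perimeter : ℝ
  perimeter = dist A B +ᴿ dist B C +ᴿ dist C D +ᴿ dist D A

  area : ℝ
  area = ∣ det (B -ᶜ A) (D -ᶜ A) ∣ᴿ

  IsEquable : Set
  IsEquable = perimeter ≃ area

  HasEisensteinVertices : Set
  HasEisensteinVertices = A ∈ℤ[ω] × B ∈ℤ[ω] × C ∈ℤ[ω] × D ∈ℤ[ω]

  IsELEP : Set
  IsELEP = IsEquable × HasEisensteinVertices

  -- Opposite sides have equal length, so two adjacent sides suffice.
  HasSideLengths : ℝ → ℝ → Set
  HasSideLengths ℓ₁ ℓ₂ = dist A B ≃ ℓ₁ × dist B C ≃ ℓ₂

{-# OPTIONS --safe #-}

-- Let u and v span the parallelogram. Its sides and area prescribe |u|² = 3 a²,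
-- |v|² = 3 b² and |det| = 4 (a + b), the last in units of the basis 1, ω. Then
-- |u|² |v|² = ⟨u, v⟩² + (3/4) det² makes 9 a² b² − 12 (a + b)² = ⟨u, v⟩² a square.
-- Conversely, if it is k², then 3 divides k and a + b, so with k = 3 l and
-- a + b = 3 c the number z = l + 2 c √-3 has norm (a b)². Since ℤ[ω] is
-- Euclidean, each prime p of a contributes a divisor of z of norm p²; hence
-- z = u v with norms a² and b², and √-3 u, √-3 v̄ span the parallelogram.

module Submission where

open import Defs
open import Data.Integer using (ℤ; +_; _+_; _*_; _-_; _^_)
open import Data.Nat using (ℕ; NonZero)
open import Data.Product using (∃-syntax; _×_)
open import Function.Bundles using (_⇔_)
open import Relation.Binary.PropositionalEquality using (_≡_)

open import Data.Integer using (-_; 0ℤ; 1ℤ; ∣_∣; -[1+_])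
import Data.Integer as ℤ
import Data.Integer.Divisibility.Signed as ℤ∣
import Data.Integer.DivMod as ℤ
import Data.Integer.Properties as ℤ
open import Data.Integer.Tactic.RingSolver using (solve-∀)
open import Data.List.Base using ([]; _∷_)
open import Data.List.Relation.Unary.All using (All; []; _∷_)
open import Data.Nat using (suc)
import Data.Nat as ℕ
import Data.Nat.Divisibility as ℕ
open import Data.Nat.Induction using (<-wellFounded; Acc; acc)
open import Data.Nat.ListAction using (product)
open import Data.Nat.Primality
  using (Prime; prime?; prime[2]; ¬prime[1]; euclidsLemma; prime⇒irreducible; prime⇒nonZero)
open import Data.Nat.Primality.Factorisation using (factorise; module PrimeFactorisation)
import Data.Nat.Properties as ℕ
import Data.Nat.Tactic.RingSolver as ℕ-Tactic
open import Data.Product using (_,_; proj₁; proj₂)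
open import Data.Rational using (ℚ; 0ℚ; 1ℚ; ½)
import Data.Rational as ℚ
import Data.Rational.Properties as ℚ
open import Data.Rational.Solver using () renaming (module +-*-Solver to ℚ-Solver)
open import Data.Sum using (_⊎_; inj₁; inj₂; reduce)
open import Function.Base using (case_of_)
open import Function.Bundles using (mk⇔; Equivalence)
open import Relation.Binary.Bundles using (Setoid)
open import Relation.Binary.Definitions using (tri<; tri≈; tri>)
open import Relation.Binary.PropositionalEquality
  using (_≢_; refl; sym; trans; cong; cong₂; subst; subst₂; module ≡-Reasoning)
import Relation.Binary.Reasoning.Setoid as SetoidReasoning
open import Relation.Nullary using (¬_; yes; no; contradiction)
open import Relation.Nullary.Decidable using (from-yes)

-- The Euclidean ring ℤ[ω]

-- The constant 4 (a + b) comes from the area: lattice vectors with integer cross product δ span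
-- area (√3/2)|δ|, while the perimeter is 2 (a + b) √3. Squaring removes both √3 and the sign of δ
-- and leaves rational constants, for which equality of reals is equality of integers after clearing
-- denominators.
--
-- In the converse, a single gcd of z with a may be too small: if π has prime norm p ≠ 3, then π and
-- its conjugate are coprime, z = π² has norm p², yet gcd (z, p) = π has norm only p. Hence a gcd of
-- norm p is divided out and a second gcd is taken with the cofactor, and the primes of a are
-- treated one at a time, always on the cofactor left so far.
--
-- The conjugate on v is there because the cross product of u and v̄ depends only on u v: up to sign
-- it is the ω-coefficient of that product, which is known from z. The factor √-3 supplies the 3 in
-- the squared side lengths.

infix  4 _∣ᴱ_
infixl 6 _⊕_
infixl 7 _⊗_
infix  8 ⊝_

-- ⟨ x , y ⟩ stands for x + y ω. Without η, ring operations on variables do not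
-- unfold into integer polynomials.
record 𝔼 : Set where
  no-eta-equality
  pattern
  constructor ⟨_,_⟩
  field
    one-coeff ω-coeff : ℤ

-- Products are reduced by ω² = -1 - ω.
_⊕_ _⊗_ : 𝔼 → 𝔼 → 𝔼
⟨ x , y ⟩ ⊕ ⟨ u , v ⟩ = ⟨ x + u , y + v ⟩
⟨ x , y ⟩ ⊗ ⟨ u , v ⟩ = ⟨ x * u - y * v , x * v + y * u - y * v ⟩

-- The complex conjugate of ω is -1 - ω.
conj ⊝_ : 𝔼 → 𝔼
conj ⟨ x , y ⟩ = ⟨ x - y , - y ⟩
⊝ ⟨ x , y ⟩ = ⟨ - x , - y ⟩

0ᴱ 1ᴱ : 𝔼
0ᴱ = ⟨ 0ℤ , 0ℤ ⟩
1ᴱ = ⟨ 1ℤ , 0ℤ ⟩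

norm : 𝔼 → ℤ
norm ⟨ x , y ⟩ = x * x - x * y + y * y

‖_‖ : 𝔼 → ℕ
‖ z ‖ = ∣ norm z ∣

_∣ᴱ_ : 𝔼 → 𝔼 → Set
z ∣ᴱ w = ∃[ k ] w ≡ z ⊗ k

⊗-assoc : ∀ z w t → (z ⊗ w) ⊗ t ≡ z ⊗ (w ⊗ t)
⊗-assoc ⟨ a , b ⟩ ⟨ c , d ⟩ ⟨ e , f ⟩ = cong₂ ⟨_,_⟩ (lem₁ a b c d e f) (lem₂ a b c d e f)
  where
  lem₁ : ∀ a b c d e f →
    (a * c - b * d) * e - (a * d + b * c - b * d) * f ≡
    a * (c * e - d * f) - b * (c * f + d * e - d * f)
  lem₁ = solve-∀
  lem₂ : ∀ a b c d e f →
    (a * c - b * d) * f + (a * d + b * c - b * d) * e - (a * d + b * c - b * d) * f ≡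
    a * (c * f + d * e - d * f) + b * (c * e - d * f) - b * (c * f + d * e - d * f)
  lem₂ = solve-∀

⊗-comm : ∀ z w → z ⊗ w ≡ w ⊗ z
⊗-comm ⟨ a , b ⟩ ⟨ c , d ⟩ = cong₂ ⟨_,_⟩ (lem₁ a b c d) (lem₂ a b c d)
  where
  lem₁ : ∀ a b c d → a * c - b * d ≡ c * a - d * b
  lem₁ = solve-∀
  lem₂ : ∀ a b c d → a * d + b * c - b * d ≡ c * b + d * a - d * b
  lem₂ = solve-∀

⊗-distribˡ-⊕ : ∀ z w t → z ⊗ (w ⊕ t) ≡ z ⊗ w ⊕ z ⊗ t
⊗-distribˡ-⊕ ⟨ a , b ⟩ ⟨ c , d ⟩ ⟨ e , f ⟩ = cong₂ ⟨_,_⟩ (lem₁ a b c d e f) (lem₂ a b c d e f)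
  where
  lem₁ : ∀ a b c d e f → a * (c + e) - b * (d + f) ≡ a * c - b * d + (a * e - b * f)
  lem₁ = solve-∀
  lem₂ : ∀ a b c d e f → a * (d + f) + b * (c + e) - b * (d + f) ≡
    a * d + b * c - b * d + (a * f + b * e - b * f)
  lem₂ = solve-∀

⊗-distribʳ-⊕ : ∀ t z w → (z ⊕ w) ⊗ t ≡ z ⊗ t ⊕ w ⊗ t
⊗-distribʳ-⊕ t z w = begin
  (z ⊕ w) ⊗ t     ≡⟨ ⊗-comm (z ⊕ w) t ⟩
  t ⊗ (z ⊕ w)     ≡⟨ ⊗-distribˡ-⊕ t z w ⟩
  t ⊗ z ⊕ t ⊗ w   ≡⟨ cong₂ _⊕_ (⊗-comm t z) (⊗-comm t w) ⟩
  z ⊗ t ⊕ w ⊗ t   ∎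
  where open ≡-Reasoning

⊕-identityʳ : ∀ z → z ⊕ 0ᴱ ≡ z
⊕-identityʳ ⟨ x , y ⟩ = cong₂ ⟨_,_⟩ (ℤ.+-identityʳ x) (ℤ.+-identityʳ y)

⊗-identityʳ : ∀ z → z ⊗ 1ᴱ ≡ z
⊗-identityʳ ⟨ x , y ⟩ = cong₂ ⟨_,_⟩ (lem₁ x y) (lem₂ x y)
  where
  lem₁ : ∀ x y → x * 1ℤ - y * 0ℤ ≡ x
  lem₁ = solve-∀
  lem₂ : ∀ x y → x * 0ℤ + y * 1ℤ - y * 0ℤ ≡ y
  lem₂ = solve-∀

⊗-identityˡ : ∀ z → 1ᴱ ⊗ z ≡ z
⊗-identityˡ z = trans (⊗-comm 1ᴱ z) (⊗-identityʳ z)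

⊗-zeroʳ : ∀ z → z ⊗ 0ᴱ ≡ 0ᴱ
⊗-zeroʳ ⟨ x , y ⟩ = cong₂ ⟨_,_⟩ (lem₁ x y) (lem₂ x y)
  where
  lem₁ : ∀ x y → x * 0ℤ - y * 0ℤ ≡ 0ℤ
  lem₁ = solve-∀
  lem₂ : ∀ x y → x * 0ℤ + y * 0ℤ - y * 0ℤ ≡ 0ℤ
  lem₂ = solve-∀

norm-⊗ : ∀ z w → norm (z ⊗ w) ≡ norm z * norm w
norm-⊗ ⟨ a , b ⟩ ⟨ c , d ⟩ = lem a b c d
  where
  lem : ∀ a b c d → let x = a * c - b * d; y = a * d + b * c - b * d in
    x * x - x * y + y * y ≡ (a * a - a * b + b * b) * (c * c - c * d + d * d)
  lem = solve-∀

‖‖-⊗ : ∀ z w → ‖ z ⊗ w ‖ ≡ ‖ z ‖ ℕ.* ‖ w ‖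
‖‖-⊗ z w = trans (cong ∣_∣ (norm-⊗ z w)) (ℤ.abs-* (norm z) (norm w))

norm-conj : ∀ z → norm (conj z) ≡ norm z
norm-conj ⟨ x , y ⟩ = lem x y
  where
  lem : ∀ x y → (x - y) * (x - y) - (x - y) * (- y) + - y * - y ≡ x * x - x * y + y * y
  lem = solve-∀

i*i≡+∣i∣² : ∀ i → i * i ≡ + (∣ i ∣ ℕ.* ∣ i ∣)
i*i≡+∣i∣² (+ n)    = sym (ℤ.pos-* n n)
i*i≡+∣i∣² -[1+ n ] = refl

-- Completing the square gives (2x - y)² + 3y². Written as the cast of a natural number, it shows at
-- once that the norm is nonnegative and vanishes only at zero.
4*norm : ∀ x y → + 4 * norm ⟨ x , y ⟩ ≡
  + (∣ + 2 * x - y ∣ ℕ.* ∣ + 2 * x - y ∣ ℕ.+ 3 ℕ.* (∣ y ∣ ℕ.* ∣ y ∣))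
4*norm x y = begin
  + 4 * (x * x - x * y + y * y)     ≡⟨ lem x y ⟩
  s * s + + 3 * (y * y)             ≡⟨ cong₂ (λ i j → i + + 3 * j) (i*i≡+∣i∣² s) (i*i≡+∣i∣² y) ⟩
  + (∣ s ∣ ℕ.* ∣ s ∣) + + 3 * + (∣ y ∣ ℕ.* ∣ y ∣)
    ≡⟨ cong (λ i → + (∣ s ∣ ℕ.* ∣ s ∣) + i) (ℤ.pos-* 3 (∣ y ∣ ℕ.* ∣ y ∣)) ⟨
  + (∣ s ∣ ℕ.* ∣ s ∣) + + (3 ℕ.* (∣ y ∣ ℕ.* ∣ y ∣)) ≡⟨ ℤ.pos-+ (∣ s ∣ ℕ.* ∣ s ∣) (3 ℕ.* (∣ y ∣ ℕ.* ∣ y ∣)) ⟨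
  + (∣ s ∣ ℕ.* ∣ s ∣ ℕ.+ 3 ℕ.* (∣ y ∣ ℕ.* ∣ y ∣)) ∎
  where
  open ≡-Reasoning
  s = + 2 * x - y
  lem : ∀ x y → + 4 * (x * x - x * y + y * y) ≡ (+ 2 * x - y) * (+ 2 * x - y) + + 3 * (y * y)
  lem = solve-∀

norm-nonNeg : ∀ z → 0ℤ ℤ.≤ norm z
norm-nonNeg ⟨ x , y ⟩ = ℤ.*-cancelˡ-≤-pos 0ℤ (norm ⟨ x , y ⟩) (+ 4)
  (subst (0ℤ ℤ.≤_) (sym (4*norm x y)) (ℤ.+≤+ ℕ.z≤n))

+‖‖≡norm : ∀ z → + ‖ z ‖ ≡ norm z
+‖‖≡norm z = ℤ.0≤i⇒+∣i∣≡i (norm-nonNeg z)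

∣i∣²≡0⇒i≡0 : ∀ i → ∣ i ∣ ℕ.* ∣ i ∣ ≡ 0 → i ≡ 0ℤ
∣i∣²≡0⇒i≡0 i eq with ℕ.m*n≡0⇒m≡0∨n≡0 ∣ i ∣ eq
... | inj₁ ∣i∣≡0 = ℤ.∣i∣≡0⇒i≡0 ∣i∣≡0
... | inj₂ ∣i∣≡0 = ℤ.∣i∣≡0⇒i≡0 ∣i∣≡0

‖z‖≡0⇒z≡0 : ∀ z → ‖ z ‖ ≡ 0 → z ≡ 0ᴱ
‖z‖≡0⇒z≡0 z@(⟨ x , y ⟩) ‖z‖≡0 = cong₂ ⟨_,_⟩ x≡0 y≡0
  where
  s = + 2 * x - y
  sum≡0 : ∣ s ∣ ℕ.* ∣ s ∣ ℕ.+ 3 ℕ.* (∣ y ∣ ℕ.* ∣ y ∣) ≡ 0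
  sum≡0 = ℤ.+-injective (trans (sym (4*norm x y)) (cong (+ 4 *_) (ℤ.∣i∣≡0⇒i≡0 ‖z‖≡0)))
  y≡0 : y ≡ 0ℤ
  y≡0 = ∣i∣²≡0⇒i≡0 y (ℕ.*-cancelˡ-≡ (∣ y ∣ ℕ.* ∣ y ∣) 0 3
    (ℕ.m+n≡0⇒n≡0 (∣ s ∣ ℕ.* ∣ s ∣) sum≡0))
  s≡0 : s ≡ 0ℤ
  s≡0 = ∣i∣²≡0⇒i≡0 s (ℕ.m+n≡0⇒m≡0 (∣ s ∣ ℕ.* ∣ s ∣) sum≡0)
  x≡0 : x ≡ 0ℤ
  x≡0 = ℤ.*-cancelˡ-≡ (+ 2) x 0ℤ (trans (ℤ.i-j≡0⇒i≡j (+ 2 * x) y s≡0) y≡0)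

-- Rounding `i` / `n` to a nearest integer. Both sides are doubled so that the error bound of one
-- half stays integral.
nearest : ∀ i n .{{_ : NonZero n}} → ∃[ q ] ∣ + 2 * (i - q * + n) ∣ ℕ.≤ n
nearest i n with 2 ℕ.* (i ℤ.%ℕ n) ℕ.≤? n
... | yes 2r≤n = i ℤ./ℕ n , subst (ℕ._≤ n) (cong ∣_∣ eq) 2r≤n
  where
  q = i ℤ./ℕ n
  r = i ℤ.%ℕ n
  lem : ∀ r p → + 2 * r ≡ + 2 * (r + p - p)
  lem = solve-∀
  eq : + (2 ℕ.* r) ≡ + 2 * (i - q * + n)
  eq = trans (ℤ.pos-* 2 r) (trans (lem (+ r) (q * + n))
    (cong (λ j → + 2 * (j - q * + n)) (sym (ℤ.a≡a%ℕn+[a/ℕn]*n i n))))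
-- The remainder exceeds half of `n`, so rounding up leaves the doubled error 2n - 2r, which is
-- below `n`.
... | no 2r≰n = i ℤ./ℕ n + 1ℤ , subst (ℕ._≤ n) (sym ∣eq∣) bound
  where
  open ≡-Reasoning
  q = i ℤ./ℕ n
  r = i ℤ.%ℕ n
  lem : ∀ r q n → + 2 * (r + q * n - (q + 1ℤ) * n) ≡ + 2 * r - + 2 * n
  lem = solve-∀
  ∣eq∣ : ∣ + 2 * (i - (q + 1ℤ) * + n) ∣ ≡ 2 ℕ.* n ℕ.∸ 2 ℕ.* r
  ∣eq∣ = begin
    ∣ + 2 * (i - (q + 1ℤ) * + n) ∣
      ≡⟨ cong (λ j → ∣ + 2 * (j - (q + 1ℤ) * + n) ∣) (ℤ.a≡a%ℕn+[a/ℕn]*n i n) ⟩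
    ∣ + 2 * (+ r + q * + n - (q + 1ℤ) * + n) ∣  ≡⟨ cong ∣_∣ (lem (+ r) q (+ n)) ⟩
    ∣ + 2 * + r - + 2 * + n ∣                   ≡⟨ cong₂ (λ j k → ∣ j - k ∣) (ℤ.pos-* 2 r) (ℤ.pos-* 2 n) ⟨
    ∣ + (2 ℕ.* r) - + (2 ℕ.* n) ∣               ≡⟨ cong ∣_∣ (ℤ.m-n≡m⊖n (2 ℕ.* r) (2 ℕ.* n)) ⟩
    ∣ 2 ℕ.* r ℤ.⊖ 2 ℕ.* n ∣
      ≡⟨ ℤ.∣⊖∣-≤ (ℕ.*-monoʳ-≤ 2 (ℕ.<⇒≤ (ℤ.n%ℕd<d i n))) ⟩
    2 ℕ.* n ℕ.∸ 2 ℕ.* r                         ∎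
  bound : 2 ℕ.* n ℕ.∸ 2 ℕ.* r ℕ.≤ n
  bound = ℕ.m≤n+o⇒m∸n≤o (2 ℕ.* n) (2 ℕ.* r)
    (ℕ.+-mono-≤ (ℕ.<⇒≤ (ℕ.≰⇒> 2r≰n)) (ℕ.≤-reflexive (ℕ.+-identityʳ n)))

-- This is what makes ℤ[ω] norm-Euclidean: by the triangle inequality the three terms of four times
-- the norm add up to at most 3n², which is strictly below 4n².
‖‖-bound : ∀ i j n .{{_ : NonZero n}} → ∣ + 2 * i ∣ ℕ.≤ n → ∣ + 2 * j ∣ ℕ.≤ n → ‖ ⟨ i , j ⟩ ‖ ℕ.< n ℕ.* n
‖‖-bound i j n h k = ℕ.*-cancelˡ-< 4 ‖ ⟨ i , j ⟩ ‖ (n ℕ.* n)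
  (ℕ.≤-<-trans (ℕ.≤-trans (ℕ.≤-reflexive eq) bound)
    (ℕ.*-monoˡ-< (n ℕ.* n) {{ℕ.m*n≢0 n n}} (ℕ.n<1+n 3)))
  where
  s = + 2 * i
  t = + 2 * j
  lem : ∀ i j → + 4 * (i * i - i * j + j * j) ≡
    (+ 2 * i) * (+ 2 * i) - (+ 2 * i) * (+ 2 * j) + (+ 2 * j) * (+ 2 * j)
  lem = solve-∀
  eq : 4 ℕ.* ‖ ⟨ i , j ⟩ ‖ ≡ ∣ s * s - s * t + t * t ∣
  eq = trans (sym (ℤ.abs-* (+ 4) (norm ⟨ i , j ⟩))) (cong ∣_∣ (lem i j))
  mul : ∀ s t → ∣ s ∣ ℕ.≤ n → ∣ t ∣ ℕ.≤ n → ∣ s * t ∣ ℕ.≤ n ℕ.* n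
  mul s t h k = subst (ℕ._≤ n ℕ.* n) (sym (ℤ.abs-* s t)) (ℕ.*-mono-≤ h k)
  sum : ∀ m → m ℕ.+ m ℕ.+ m ≡ 3 ℕ.* m
  sum = ℕ-Tactic.solve-∀
  bound : ∣ s * s - s * t + t * t ∣ ℕ.≤ 3 ℕ.* (n ℕ.* n)
  bound = ℕ.≤-trans (ℤ.∣i+j∣≤∣i∣+∣j∣ (s * s - s * t) (t * t))
    (ℕ.≤-trans (ℕ.+-mono-≤
      (ℕ.≤-trans (ℤ.∣i-j∣≤∣i∣+∣j∣ (s * s) (s * t)) (ℕ.+-mono-≤ (mul s s h h) (mul s t h k)))
      (mul t t k k))
    (ℕ.≤-reflexive (sum (n ℕ.* n))))

-- The quotient is z · conj w / norm w with both coordinates rounded; the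
-- remainder is measured after multiplying it by conj w.
divide : ∀ z w .{{_ : NonZero ‖ w ‖}} → ∃[ q ] ‖ z ⊕ w ⊗ ⊝ q ‖ ℕ.< ‖ w ‖
divide z@(⟨ a , b ⟩) w@(⟨ c , d ⟩) =
  let u , u-close = nearest e n
      v , v-close = nearest f n
      r           = z ⊕ w ⊗ ⊝ ⟨ u , v ⟩
  in ⟨ u , v ⟩ , ℕ.*-cancelʳ-< n ‖ r ‖ n
       (subst (ℕ._< n ℕ.* n) (scaled u v) (‖‖-bound (e - u * + n) (f - v * + n) n u-close v-close))
  where
  open ≡-Reasoning
  n = ‖ w ‖
  e = a * (c - d) - b * (- d)
  f = a * (- d) + b * (c - d) - b * (- d)

  lem₁ : ∀ a b c d u v →
    a * (c - d) - b * (- d) - u * (c * c - c * d + d * d) ≡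
    (a + (c * - u - d * - v)) * (c - d) - (b + (c * - v + d * - u - d * - v)) * (- d)
  lem₁ = solve-∀

  lem₂ : ∀ a b c d u v →
    a * (- d) + b * (c - d) - b * (- d) - v * (c * c - c * d + d * d) ≡
    (a + (c * - u - d * - v)) * (- d) + (b + (c * - v + d * - u - d * - v)) * (c - d)
      - (b + (c * - v + d * - u - d * - v)) * (- d)
  lem₂ = solve-∀

  scaled : ∀ u v → ‖ ⟨ e - u * + n , f - v * + n ⟩ ‖ ≡ ‖ z ⊕ w ⊗ ⊝ ⟨ u , v ⟩ ‖ ℕ.* n
  scaled u v = begin
    ‖ ⟨ e - u * + n , f - v * + n ⟩ ‖
      ≡⟨ cong (λ k → ‖ ⟨ e - u * k , f - v * k ⟩ ‖) (+‖‖≡norm w) ⟩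
    ‖ ⟨ e - u * norm w , f - v * norm w ⟩ ‖
      ≡⟨ cong ‖_‖ (cong₂ ⟨_,_⟩ (lem₁ a b c d u v) (lem₂ a b c d u v)) ⟩
    ‖ (z ⊕ w ⊗ ⊝ ⟨ u , v ⟩) ⊗ conj w ‖        ≡⟨ ‖‖-⊗ (z ⊕ w ⊗ ⊝ ⟨ u , v ⟩) (conj w) ⟩
    ‖ z ⊕ w ⊗ ⊝ ⟨ u , v ⟩ ‖ ℕ.* ‖ conj w ‖
      ≡⟨ cong (λ k → ‖ z ⊕ w ⊗ ⊝ ⟨ u , v ⟩ ‖ ℕ.* ∣ k ∣) (norm-conj w) ⟩
    ‖ z ⊕ w ⊗ ⊝ ⟨ u , v ⟩ ‖ ℕ.* n             ∎

-- Euclid's algorithm, replacing the pair `z`, `w` by `w`, z - wq. The norm of the second entry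
-- decreases, and a linear combination of the new pair is one of the old pair.
bézout : ∀ z w → ∃[ g ] ∃[ s ] ∃[ t ] g ≡ z ⊗ s ⊕ w ⊗ t × g ∣ᴱ z × g ∣ᴱ w
bézout z w = go z w (<-wellFounded ‖ w ‖)
  where
  zero-case : ∀ z → z ≡ z ⊗ 1ᴱ ⊕ 0ᴱ ⊗ 0ᴱ
  zero-case z = trans (sym (⊗-identityʳ z)) (sym (⊕-identityʳ (z ⊗ 1ᴱ)))

  swap-⊕ : ∀ x y z → x ⊕ (y ⊕ z) ≡ y ⊕ (x ⊕ z)
  swap-⊕ ⟨ a , b ⟩ ⟨ c , d ⟩ ⟨ e , f ⟩ = cong₂ ⟨_,_⟩ (lem a c e) (lem b d f)
    where
    lem : ∀ i j k → i + (j + k) ≡ j + (i + k)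
    lem = solve-∀

  shift : ∀ z w q s t → w ⊗ s ⊕ (z ⊕ w ⊗ q) ⊗ t ≡ z ⊗ t ⊕ w ⊗ (s ⊕ q ⊗ t)
  shift z w q s t = begin
    w ⊗ s ⊕ (z ⊕ w ⊗ q) ⊗ t       ≡⟨ cong (w ⊗ s ⊕_) (⊗-distribʳ-⊕ t z (w ⊗ q)) ⟩
    w ⊗ s ⊕ (z ⊗ t ⊕ w ⊗ q ⊗ t)   ≡⟨ swap-⊕ (w ⊗ s) (z ⊗ t) (w ⊗ q ⊗ t) ⟩
    z ⊗ t ⊕ (w ⊗ s ⊕ w ⊗ q ⊗ t)   ≡⟨ cong (λ k → z ⊗ t ⊕ (w ⊗ s ⊕ k)) (⊗-assoc w q t) ⟩
    z ⊗ t ⊕ (w ⊗ s ⊕ w ⊗ (q ⊗ t)) ≡⟨ cong (z ⊗ t ⊕_) (⊗-distribˡ-⊕ w s (q ⊗ t)) ⟨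
    z ⊗ t ⊕ w ⊗ (s ⊕ q ⊗ t)       ∎
    where open ≡-Reasoning

  restore : ∀ z w q → w ⊗ q ⊕ (z ⊕ w ⊗ ⊝ q) ≡ z
  restore ⟨ a , b ⟩ ⟨ c , d ⟩ ⟨ e , f ⟩ = cong₂ ⟨_,_⟩ (lem₁ a c d e f) (lem₂ b c d e f)
    where
    lem₁ : ∀ a c d e f → c * e - d * f + (a + (c * - e - d * - f)) ≡ a
    lem₁ = solve-∀
    lem₂ : ∀ b c d e f → c * f + d * e - d * f + (b + (c * - f + d * - e - d * - f)) ≡ b
    lem₂ = solve-∀

  ∣ᴱ-combine : ∀ g w r q → g ∣ᴱ w → g ∣ᴱ r → g ∣ᴱ (w ⊗ q ⊕ r)
  ∣ᴱ-combine g w r q (k , w≡gk) (l , r≡gl) = k ⊗ q ⊕ l , (begin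
    w ⊗ q ⊕ r             ≡⟨ cong₂ (λ w r → w ⊗ q ⊕ r) w≡gk r≡gl ⟩
    g ⊗ k ⊗ q ⊕ g ⊗ l     ≡⟨ cong (_⊕ g ⊗ l) (⊗-assoc g k q) ⟩
    g ⊗ (k ⊗ q) ⊕ g ⊗ l   ≡⟨ ⊗-distribˡ-⊕ g (k ⊗ q) l ⟨
    g ⊗ (k ⊗ q ⊕ l)       ∎)
    where open ≡-Reasoning

  Bézout : 𝔼 → 𝔼 → Set
  Bézout z w = ∃[ g ] ∃[ s ] ∃[ t ] g ≡ z ⊗ s ⊕ w ⊗ t × g ∣ᴱ z × g ∣ᴱ w

  base : ∀ z w → w ≡ 0ᴱ → Bézout z w
  base z w w≡0 = subst (Bézout z) (sym w≡0)
    (z , 1ᴱ , 0ᴱ , zero-case z , (1ᴱ , sym (⊗-identityʳ z)) , (0ᴱ , sym (⊗-zeroʳ z)))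

  step : ∀ z w q → Bézout w (z ⊕ w ⊗ ⊝ q) → Bézout z w
  step z w q (g , s , t , g≡ , g∣w , g∣r) =
    g , t , s ⊕ ⊝ q ⊗ t , trans g≡ (shift z w (⊝ q) s t) ,
    subst (g ∣ᴱ_) (restore z w q) (∣ᴱ-combine g w (z ⊕ w ⊗ ⊝ q) q g∣w g∣r) , g∣w

  go : ∀ z w → Acc ℕ._<_ ‖ w ‖ → Bézout z w
  go z w (acc rec) = case ‖ w ‖ ℕ.≟ 0 of λ where
    (yes ‖w‖≡0) → base z w (‖z‖≡0⇒z≡0 w ‖w‖≡0)
    (no  ‖w‖≢0) → let q , r<w = divide z w {{ℕ.≢-nonZero ‖w‖≢0}} in
      step z w q (go w (z ⊕ w ⊗ ⊝ q) (rec r<w))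

-- Divisors of prescribed square norm

-- The norm is a quadratic form, so a shift by a multiple of `p` changes it by `p` times a polar
-- term plus p² times a norm. Thus `p` divides the norm of a combination of `z` and `p` as soon as
-- it divides the norm of `z`.
norm-+-mod : ∀ z p w → ∃[ k ] norm (z ⊕ ⟨ p , 0ℤ ⟩ ⊗ w) ≡ norm z + p * k
norm-+-mod ⟨ x , y ⟩ p ⟨ u , v ⟩ =
  + 2 * x * u - x * v - y * u + + 2 * y * v + p * (u * u - u * v + v * v) ,
  lem x y p u v
  where
  lem : ∀ x y p u v → let s = x + (p * u - 0ℤ); t = y + (p * v + 0ℤ - 0ℤ) in
    s * s - s * t + t * t ≡
    x * x - x * y + y * y +
      p * (+ 2 * x * u - x * v - y * u + + 2 * y * v + p * (u * u - u * v + v * v))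
  lem = solve-∀

norm-fromℤ : ∀ n → ‖ ⟨ + n , 0ℤ ⟩ ‖ ≡ n ℕ.* n
norm-fromℤ n = trans (cong ∣_∣ (lem (+ n))) (ℤ.abs-* (+ n) (+ n))
  where
  lem : ∀ i → i * i - i * 0ℤ + 0ℤ ≡ i * i
  lem = solve-∀

data SquareDivisor (p m : ℕ) : Set where
  ≡1  : m ≡ 1 → SquareDivisor p m
  ≡p  : m ≡ p → SquareDivisor p m
  ≡p² : m ≡ p ℕ.* p → SquareDivisor p m

divisors-of-p² : ∀ {p} → Prime p → ∀ m n → m ℕ.* n ≡ p ℕ.* p → SquareDivisor p m
divisors-of-p² {p} p-prime m n mn≡p² with euclidsLemma m n p-prime (ℕ.divides p mn≡p²)
... | inj₁ (ℕ.divides k refl) with prime⇒irreducible p-prime (ℕ.divides n (sym nk≡p))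
  where
  instance _ = prime⇒nonZero p-prime
  lem : ∀ n k p → n ℕ.* k ℕ.* p ≡ k ℕ.* p ℕ.* n
  lem = ℕ-Tactic.solve-∀
  nk≡p : n ℕ.* k ≡ p
  nk≡p = ℕ.*-cancelʳ-≡ (n ℕ.* k) p p (trans (lem n k p) mn≡p²)
... | inj₁ refl = ≡p (ℕ.*-identityˡ p)
... | inj₂ refl = ≡p² refl
divisors-of-p² {p} p-prime m n mn≡p² | inj₂ (ℕ.divides k refl)
  with prime⇒irreducible p-prime (ℕ.divides k (sym km≡p))
  where
  instance _ = prime⇒nonZero p-prime
  lem : ∀ m k p → k ℕ.* m ℕ.* p ≡ m ℕ.* (k ℕ.* p)
  lem = ℕ-Tactic.solve-∀
  km≡p : k ℕ.* m ≡ p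
  km≡p = ℕ.*-cancelʳ-≡ (k ℕ.* m) p p (trans (lem m k p) mn≡p²)
... | inj₁ m≡1 = ≡1 m≡1
... | inj₂ m≡p = ≡p m≡p

-- The divisor is a gcd of `z` and `p`. Its norm divides p², the norm of `p`; norm 1 is excluded
-- because the gcd is a combination z s + p t, whose norm is divisible by `p`.
prime-divisor : ∀ {p} → Prime p → ∀ z → p ℕ.∣ ‖ z ‖ →
  ∃[ g ] g ∣ᴱ z × (‖ g ‖ ≡ p ⊎ ‖ g ‖ ≡ p ℕ.* p)
prime-divisor {p} p-prime z p∣‖z‖ =
  let g , s , t , g≡ , g∣z , (k , p≡gk) = bézout z ⟨ + p , 0ℤ ⟩
  in g , g∣z , cases g s t g≡ (divisors-of-p² p-prime ‖ g ‖ ‖ k ‖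
       (trans (sym (‖‖-⊗ g k)) (trans (cong ‖_‖ (sym p≡gk)) (norm-fromℤ p))))
  where
  p∣norm : ∀ s t → + p ℤ∣.∣ norm (z ⊗ s ⊕ ⟨ + p , 0ℤ ⟩ ⊗ t)
  p∣norm s t = let m , eq = norm-+-mod (z ⊗ s) (+ p) t in
    subst (+ p ℤ∣.∣_) (sym eq)
      (ℤ∣.∣m∣n⇒∣m+n
        (subst (+ p ℤ∣.∣_) (sym (norm-⊗ z s)) (ℤ∣.∣m⇒∣m*n (norm s) (ℤ∣.∣ᵤ⇒∣ {+ p} {norm z} p∣‖z‖)))
        (ℤ∣.∣m⇒∣m*n m ℤ∣.∣-refl))

  cases : ∀ g s t → g ≡ z ⊗ s ⊕ ⟨ + p , 0ℤ ⟩ ⊗ t → SquareDivisor p ‖ g ‖ → ‖ g ‖ ≡ p ⊎ ‖ g ‖ ≡ p ℕ.* p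
  cases g s t g≡ (≡p eq)  = inj₁ eq
  cases g s t g≡ (≡p² eq) = inj₂ eq
  cases g s t g≡ (≡1 eq)  = contradiction (subst Prime (ℕ.∣1⇒≡1 p∣1) p-prime) ¬prime[1]
    where
    p∣1 : p ℕ.∣ 1
    p∣1 = subst (p ℕ.∣_) eq (ℤ∣.∣⇒∣ᵤ (subst (λ g → + p ℤ∣.∣ norm g) (sym g≡) (p∣norm s t)))

∣ᴱ-⊗ : ∀ g h z w → z ≡ g ⊗ w → h ∣ᴱ w → g ⊗ h ∣ᴱ z
∣ᴱ-⊗ g h z w z≡gw (k , w≡hk) = k , trans z≡gw (trans (cong (g ⊗_) w≡hk) (sym (⊗-assoc g h k)))

-- If the first divisor has norm only `p`, its cofactor still has norm divisible by `p`, so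
-- `prime-divisor` applies once more.
prime-square-divisor : ∀ {p} → Prime p → ∀ z → p ℕ.* p ℕ.∣ ‖ z ‖ → ∃[ g ] g ∣ᴱ z × ‖ g ‖ ≡ p ℕ.* p
prime-square-divisor {p} p-prime z (ℕ.divides m ‖z‖≡mp²) =
  first (prime-divisor p-prime z
    (ℕ.divides (m ℕ.* p) (trans ‖z‖≡mp² (sym (ℕ.*-assoc m p p)))))
  where
  instance _ = prime⇒nonZero p-prime

  lem : ∀ m p → m ℕ.* (p ℕ.* p) ≡ p ℕ.* (m ℕ.* p)
  lem = ℕ-Tactic.solve-∀

  second : ∀ g h → z ≡ g ⊗ h → ‖ g ‖ ≡ p → ∃[ g′ ] g′ ∣ᴱ h × (‖ g′ ‖ ≡ p ⊎ ‖ g′ ‖ ≡ p ℕ.* p) →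
           ∃[ g ] g ∣ᴱ z × ‖ g ‖ ≡ p ℕ.* p
  second g h z≡gh ‖g‖≡p (g′ , g′∣h , inj₁ ‖g′‖≡p) =
    g ⊗ g′ , ∣ᴱ-⊗ g g′ z h z≡gh g′∣h , trans (‖‖-⊗ g g′) (cong₂ ℕ._*_ ‖g‖≡p ‖g′‖≡p)
  -- A divisor of norm p² found in the cofactor is the answer by itself; `g` moves into the
  -- complementary factor.
  second g h z≡gh ‖g‖≡p (g′ , (k , h≡g′k) , inj₂ ‖g′‖≡p²) =
    g′ , (k ⊗ g , trans z≡gh (trans (⊗-comm g h) (trans (cong (_⊗ g) h≡g′k) (⊗-assoc g′ k g)))) , ‖g′‖≡p²

  first : ∃[ g ] g ∣ᴱ z × (‖ g ‖ ≡ p ⊎ ‖ g ‖ ≡ p ℕ.* p) → ∃[ g ] g ∣ᴱ z × ‖ g ‖ ≡ p ℕ.* p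
  first (g , g∣z , inj₂ ‖g‖≡p²) = g , g∣z , ‖g‖≡p²
  first (g , (h , z≡gh) , inj₁ ‖g‖≡p) =
    second g h z≡gh ‖g‖≡p (prime-divisor p-prime h (ℕ.divides m ‖h‖≡mp))
    where
    ‖h‖≡mp : ‖ h ‖ ≡ m ℕ.* p
    ‖h‖≡mp = ℕ.*-cancelˡ-≡ ‖ h ‖ (m ℕ.* p) p
      (trans (cong (ℕ._* ‖ h ‖) (sym ‖g‖≡p))
        (trans (sym (‖‖-⊗ g h)) (trans (cong ‖_‖ (sym z≡gh)) (trans ‖z‖≡mp² (lem m p)))))

-- Induction on the list of prime factors of `a`. Each prime is extracted from the cofactor left by
-- the previous ones, so repeated primes are counted with multiplicity.
square-divisor : ∀ a .{{_ : NonZero a}} z → a ℕ.* a ℕ.∣ ‖ z ‖ → ∃[ g ] g ∣ᴱ z × ‖ g ‖ ≡ a ℕ.* a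
square-divisor a z a²∣‖z‖ = subst (λ a → ∃[ g ] g ∣ᴱ z × ‖ g ‖ ≡ a ℕ.* a) (sym isFactorisation)
  (go factors factorsPrime z (subst (λ a → a ℕ.* a ℕ.∣ ‖ z ‖) isFactorisation a²∣‖z‖))
  where
  open PrimeFactorisation (factorise a)

  lem : ∀ p q → p ℕ.* q ℕ.* (p ℕ.* q) ≡ p ℕ.* p ℕ.* (q ℕ.* q)
  lem = ℕ-Tactic.solve-∀

  go : ∀ ps → All Prime ps → ∀ z → product ps ℕ.* product ps ℕ.∣ ‖ z ‖ →
       ∃[ g ] g ∣ᴱ z × ‖ g ‖ ≡ product ps ℕ.* product ps
  go []       []                z _   = 1ᴱ , (z , sym (⊗-identityˡ z)) , refl
  go (p ∷ ps) (p-prime ∷ prime) z [pq]²∣‖z‖ =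
    let g , (h , z≡gh) , ‖g‖≡p² = prime-square-divisor p-prime z
          (ℕ.∣-trans (ℕ.m∣m*n (q ℕ.* q)) p²q²∣‖z‖)
        g′ , g′∣h , ‖g′‖≡q² = go ps prime h
          (ℕ.*-cancelˡ-∣ (p ℕ.* p) {{ℕ.m*n≢0 p p}}
            (subst (p ℕ.* p ℕ.* (q ℕ.* q) ℕ.∣_)
              (trans (cong ‖_‖ z≡gh) (trans (‖‖-⊗ g h) (cong (ℕ._* ‖ h ‖) ‖g‖≡p²))) p²q²∣‖z‖))
    in g ⊗ g′ , ∣ᴱ-⊗ g g′ z h z≡gh g′∣h ,
       trans (‖‖-⊗ g g′) (trans (cong₂ ℕ._*_ ‖g‖≡p² ‖g′‖≡q²) (sym (lem p q)))
    where
    instance _ = prime⇒nonZero p-prime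
    q = product ps
    p²q²∣‖z‖ : p ℕ.* p ℕ.* (q ℕ.* q) ℕ.∣ ‖ z ‖
    p²q²∣‖z‖ = subst (ℕ._∣ ‖ z ‖) (lem p q) [pq]²∣‖z‖

split-norm : ∀ a b .{{_ : NonZero a}} z → ‖ z ‖ ≡ a ℕ.* a ℕ.* (b ℕ.* b) →
  ∃[ u ] ∃[ v ] z ≡ u ⊗ v × ‖ u ‖ ≡ a ℕ.* a × ‖ v ‖ ≡ b ℕ.* b
split-norm a b z ‖z‖≡ =
  let u , (v , z≡uv) , ‖u‖≡ = square-divisor a z
        (ℕ.divides (b ℕ.* b) (trans ‖z‖≡ (ℕ.*-comm (a ℕ.* a) (b ℕ.* b))))
  in u , v , z≡uv , ‖u‖≡ ,
     ℕ.*-cancelˡ-≡ ‖ v ‖ (b ℕ.* b) (a ℕ.* a) {{ℕ.m*n≢0 a a}}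
       (trans (cong (ℕ._* ‖ v ‖) (sym ‖u‖≡))
         (trans (sym (‖‖-⊗ u v)) (trans (cong ‖_‖ (sym z≡uv)) ‖z‖≡)))

-- Equality and square roots of Cauchy reals

infix 4 _≈_

-- _≃_ unfolds to a function type from which the two sequences cannot be
-- inferred; the record wrapper makes both sides recoverable by unification.
record _≈_ (x y : ℝ) : Set where
  constructor [_]
  field
    ≈⇒≃ : x ≃ y

open _≈_

pointwise : ∀ {x y} → (∀ n → seq x n ≡ seq y n) → x ≈ y
pointwise {x} {y} eq = [ (λ ε 0<ε → 0 , λ n _ →
  subst (ℚ._< ε) (sym (cong ℚ.∣_∣ (trans (cong (ℚ._- seq y n) (eq n)) (ℚ.+-inverseʳ (seq y n))))) 0<ε) ]

≈-refl : ∀ {x} → x ≈ x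
≈-refl {x} = pointwise {x} {x} λ _ → refl

≈-sym : ∀ {x y} → x ≈ y → y ≈ x
≈-sym {x} {y} [ x≃y ] = [ (λ ε 0<ε → let N , f = x≃y ε 0<ε in
  N , λ n h → subst (ℚ._< ε) (∣p-q∣≡∣q-p∣ (seq x n) (seq y n)) (f n h)) ]

≈-trans : ∀ {x y z} → x ≈ y → y ≈ z → x ≈ z
≈-trans {x} {y} {z} [ x≃y ] [ y≃z ] = [ (λ ε 0<ε →
  let M , f = x≃y (½ ℚ.* ε) (half-pos 0<ε)
      N , g = y≃z (½ ℚ.* ε) (half-pos 0<ε)
  in M ℕ.⊔ N , λ n h → subst₂ ℚ._<_ (cong ℚ.∣_∣ (lem (seq x n) (seq y n) (seq z n))) (½+½ ε)
       (ℚ.≤-<-trans (ℚ.∣p+q∣≤∣p∣+∣q∣ (seq x n ℚ.- seq y n) (seq y n ℚ.- seq z n))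
         (ℚ.+-mono-< (f n (ℕ.m⊔n≤o⇒m≤o M N h)) (g n (ℕ.m⊔n≤o⇒n≤o M N h))))) ]
  where
  open ℚ-Solver
  lem : ∀ p q r → (p ℚ.- q) ℚ.+ (q ℚ.- r) ≡ p ℚ.- r
  lem = solve 3 (λ p q r → (p :- q) :+ (q :- r) := p :- r) refl

≈-setoid : Setoid _ _
≈-setoid = record
  { Carrier       = ℝ
  ; _≈_           = _≈_
  ; isEquivalence = record { refl = ≈-refl ; sym = ≈-sym ; trans = ≈-trans }
  }

module ≈-Reasoning = SetoidReasoning ≈-setoid

+ᴿ-cong : ∀ {x x′ y y′} → x ≈ x′ → y ≈ y′ → x +ᴿ y ≈ x′ +ᴿ y′
+ᴿ-cong {x} {x′} {y} {y′} [ x≃x′ ] [ y≃y′ ] = [ (λ ε 0<ε →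
  let M , f = x≃x′ (½ ℚ.* ε) (half-pos 0<ε)
      N , g = y≃y′ (½ ℚ.* ε) (half-pos 0<ε)
  in M ℕ.⊔ N , λ n h → subst₂ ℚ._<_
       (cong ℚ.∣_∣ (lem (seq x n) (seq x′ n) (seq y n) (seq y′ n))) (½+½ ε)
       (ℚ.≤-<-trans (ℚ.∣p+q∣≤∣p∣+∣q∣ (seq x n ℚ.- seq x′ n) (seq y n ℚ.- seq y′ n))
         (ℚ.+-mono-< (f n (ℕ.m⊔n≤o⇒m≤o M N h)) (g n (ℕ.m⊔n≤o⇒n≤o M N h))))) ]
  where
  open ℚ-Solver
  lem : ∀ p q r s → (p ℚ.- q) ℚ.+ (r ℚ.- s) ≡ (p ℚ.+ r) ℚ.- (q ℚ.+ s)
  lem = solve 4 (λ p q r s → (p :- q) :+ (r :- s) := (p :+ r) :- (q :+ s)) refl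

-ᴿ-cong : ∀ {x y} → x ≈ y → -ᴿ x ≈ -ᴿ y
-ᴿ-cong {x} {y} [ x≃y ] = [ (λ ε 0<ε → let N , f = x≃y ε 0<ε in
  N , λ n h → subst (ℚ._< ε)
    (trans (∣p-q∣≡∣q-p∣ (seq x n) (seq y n)) (cong ℚ.∣_∣ (lem (seq x n) (seq y n)))) (f n h)) ]
  where
  open ℚ-Solver
  lem : ∀ p q → q ℚ.- p ≡ ℚ.- p ℚ.- ℚ.- q
  lem = solve 2 (λ p q → q :- p := :- p :- :- q) refl

*ᴿ-cong : ∀ {x x′ y y′} → x ≈ x′ → y ≈ y′ → x *ᴿ y ≈ x′ *ᴿ y′
*ᴿ-cong {x} {x′} {y} {y′} [ x≃x′ ] [ y≃y′ ] = [ (λ ε 0<ε →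
  let B , 0<B , K , f = bounded {seq x} (isCauchy x)
      C , 0<C , L , g = bounded {seq y′} (isCauchy y′)
      δ , 0<δ , Bδ    = scale {B} {ε} 0<B 0<ε
      η , 0<η , Cη    = scale {C} {ε} 0<C 0<ε
      M , f′          = y≃y′ δ 0<δ
      N , g′          = x≃x′ η 0<η
  in (K ℕ.⊔ L) ℕ.⊔ (M ℕ.⊔ N) , λ n h →
    let h₁ = ℕ.m⊔n≤o⇒m≤o (K ℕ.⊔ L) (M ℕ.⊔ N) h
        h₂ = ℕ.m⊔n≤o⇒n≤o (K ℕ.⊔ L) (M ℕ.⊔ N) h
    in *-close {B} {C} {δ} {η} {ε} (seq x n) (seq y n) (seq x′ n) (seq y′ n) 0<B 0<C
         (f n (ℕ.m⊔n≤o⇒m≤o K L h₁)) (g n (ℕ.m⊔n≤o⇒n≤o K L h₁))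
         (f′ n (ℕ.m⊔n≤o⇒m≤o M N h₂)) (g′ n (ℕ.m⊔n≤o⇒n≤o M N h₂)) Bδ Cη) ]

-- Uniform continuity of the root: with h = ε/2, arguments closer than h² have approximate roots
-- closer than 2h = ε once the approximation error 1/(n + 1) is at most h.
√-cong : ∀ {x y} → x ≈ y → √ x ≈ √ y
√-cong {x} {y} [ x≃y ] = [ (λ ε 0<ε →
  let h         = ½ ℚ.* ε
      0<h       = half-pos 0<ε
      N , f     = x≃y (h ℚ.* h) (*-pos 0<h 0<h)
      K , small = eventually-small 0<h
  in N ℕ.⊔ K , λ n M≤n →
    let close = f n (ℕ.m⊔n≤o⇒m≤o N K M≤n)
        1/n≤h = small n (ℕ.m⊔n≤o⇒n≤o N K M≤n)
    in within (√-approx (seq x n) n) (√-approx (seq y n) n)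
         (√-close (seq x n) (seq y n) n n h 0<h 1/n≤h close)
         (√-close (seq y n) (seq x n) n n h 0<h 1/n≤h
           (subst (ℚ._< h ℚ.* h) (∣p-q∣≡∣q-p∣ (seq x n) (seq y n)) close))) ]
  where
  within : ∀ {ε} s r → s ℚ.< r ℚ.+ (½ ℚ.* ε ℚ.+ ½ ℚ.* ε) → r ℚ.< s ℚ.+ (½ ℚ.* ε ℚ.+ ½ ℚ.* ε) →
           ℚ.∣ s ℚ.- r ∣ ℚ.< ε
  within {ε} s r s<r+ε r<s+ε = ∣p∣<ε (s ℚ.- r) (one s r s<r+ε)
    (subst (ℚ._< ε) (sym (neg-sub s r)) (one r s r<s+ε))
    where
    one : ∀ s r → s ℚ.< r ℚ.+ (½ ℚ.* ε ℚ.+ ½ ℚ.* ε) → s ℚ.- r ℚ.< ε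
    one s r s<r+ε = p<q+ε⇒p-q<ε {s} {r} {ε} (subst (λ δ → s ℚ.< r ℚ.+ δ) (½+½ ε) s<r+ε)

-- A condition on every term of the sequence, hence stronger than nonnegativity of the limit and not
-- invariant under `_≈_`. It guarantees that the truncation `_⁺` inside the root never acts.
NonNegᴿ : ℝ → Set
NonNegᴿ x = ∀ n → 0ℚ ℚ.≤ seq x n

square-cancel-≤ : ∀ {p q} → 0ℚ ℚ.≤ q → p ℚ.* p ℚ.≤ q ℚ.* q → p ℚ.≤ q
square-cancel-≤ {p} {q} 0≤q p²≤q² = ℚ.≮⇒≥ λ q<p → ℚ.<-irrefl refl
  (ℚ.<-≤-trans
    (ℚ.≤-<-trans
      (ℚ.*-monoˡ-≤-nonNeg q {{ℚ.nonNegative 0≤q}} (ℚ.<⇒≤ q<p))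
      (ℚ.*-monoˡ-<-pos p {{ℚ.positive (ℚ.≤-<-trans 0≤q q<p)}} q<p))
    p²≤q²)

square-cancel-< : ∀ {p q} → 0ℚ ℚ.≤ p → 0ℚ ℚ.≤ q → p ℚ.* p ℚ.< q ℚ.* q → p ℚ.< q
square-cancel-< 0≤p 0≤q p²<q² = ℚ.≰⇒> λ q≤p →
  ℚ.<-irrefl refl (ℚ.<-≤-trans p²<q² (*-mono-≤ 0≤p 0≤q q≤p q≤p))

⁺-nonNeg : ∀ {p} → 0ℚ ℚ.≤ p → p ⁺ ≡ p
⁺-nonNeg 0≤p = ℚ.p≥q⇒p⊔q≡p 0≤p

-- For a term p ≥ 0, the approximate root s of p² satisfies s² ≤ p² < (s + 1/(n + 1))². Cancelling
-- the squares traps p between s and s + 1/(n + 1).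
√[x*x]≈x : ∀ {x} → NonNegᴿ x → √ (x *ᴿ x) ≈ x
√[x*x]≈x {x} 0≤x = [ (λ ε 0<ε → let N , small = eventually-small 0<ε in
  N , λ n h → close (seq x n) n (0≤x n) 0<ε (small n h)) ]
  where
  close : ∀ {ε} p n → 0ℚ ℚ.≤ p → 0ℚ ℚ.< ε → (+ 1) ℚ./ suc n ℚ.≤ ε →
          ℚ.∣ √-approx (p ℚ.* p) n ℚ.- p ∣ ℚ.< ε
  close {ε} p n 0≤p 0<ε 1/n≤ε = ∣p∣<ε (s ℚ.- p)
    (p<q+ε⇒p-q<ε {s} {p} {ε} (ℚ.≤-<-trans s≤p
      (subst (ℚ._< p ℚ.+ ε) (ℚ.+-identityʳ p) (ℚ.+-monoʳ-< p 0<ε))))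
    (subst (ℚ._< ε) (sym (neg-sub s p)) (p<q+ε⇒p-q<ε {p} {s} {ε}
      (ℚ.<-≤-trans p<s+t (ℚ.+-monoʳ-≤ s 1/n≤ε))))
    where
    s = √-approx (p ℚ.* p) n
    t = (+ 1) ℚ./ suc n
    p²⁺ : (p ℚ.* p) ⁺ ≡ p ℚ.* p
    p²⁺ = ⁺-nonNeg (*-mono-≤ 0≤p ℚ.≤-refl 0≤p 0≤p)
    s≤p : s ℚ.≤ p
    s≤p = square-cancel-≤ 0≤p (subst (s ℚ.* s ℚ.≤_) p²⁺ (√-approx-lower (p ℚ.* p) n))
    p<s+t : p ℚ.< s ℚ.+ t
    p<s+t = square-cancel-< 0≤p (ℚ.+-mono-≤ (√-approx-nonNeg (p ℚ.* p) n) (0≤i/n 1 (suc n)))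
      (subst (ℚ._< (s ℚ.+ t) ℚ.* (s ℚ.+ t)) p²⁺ (√-approx-upper (p ℚ.* p) n))

√x*√x≈x : ∀ {x} → NonNegᴿ x → √ x *ᴿ √ x ≈ x
√x*√x≈x {x} 0≤x = [ (λ ε 0<ε →
  let B , 0<B , M , bound = bounded {seq (√ x)} (isCauchy (√ x))
      0<2B+1        = ℚ.+-mono-< (ℚ.+-mono-< 0<B 0<B) (ℚ.positive⁻¹ 1ℚ)
      -- With s ≤ `B` and t = 1/(n + 1) ≤ 1, the gap (s + t)² - s² = (2s + t) t is at most (2B + 1)
      -- t, hence the factor 2B + 1.
      δ , 0<δ , eq  = scale {B ℚ.+ B ℚ.+ 1ℚ} {ε} 0<2B+1 0<ε
      K , small     = eventually-small 0<δ
      L , below1    = eventually-small (ℚ.positive⁻¹ 1ℚ)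
  in M ℕ.⊔ (K ℕ.⊔ L) , λ n h →
    let h′ = ℕ.m⊔n≤o⇒n≤o M (K ℕ.⊔ L) h
    in close (seq x n) n (0≤x n) 0<ε
         (ℚ.≤-trans (p≤∣p∣ (seq (√ x) n)) (bound n (ℕ.m⊔n≤o⇒m≤o M (K ℕ.⊔ L) h)))
         0<δ (small n (ℕ.m⊔n≤o⇒m≤o K L h′)) (below1 n (ℕ.m⊔n≤o⇒n≤o K L h′)) eq) ]
  where
  half< : ∀ {ε} → 0ℚ ℚ.< ε → ½ ℚ.* ε ℚ.< ε
  half< {ε} 0<ε = subst₂ ℚ._<_ (ℚ.+-identityʳ (½ ℚ.* ε)) (½+½ ε)
    (ℚ.+-monoʳ-< (½ ℚ.* ε) (half-pos 0<ε))

  close : ∀ {ε B δ} p n → let s = √-approx p n; t = (+ 1) ℚ./ suc n in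
          0ℚ ℚ.≤ p → 0ℚ ℚ.< ε → s ℚ.≤ B → 0ℚ ℚ.< δ → t ℚ.≤ δ → t ℚ.≤ 1ℚ →
          (B ℚ.+ B ℚ.+ 1ℚ) ℚ.* δ ≡ ½ ℚ.* ε → ℚ.∣ s ℚ.* s ℚ.- p ∣ ℚ.< ε
  close {ε} {B} {δ} p n 0≤p 0<ε s≤B 0<δ t≤δ t≤1 eq = ∣p∣<ε (s ℚ.* s ℚ.- p)
    (p<q+ε⇒p-q<ε {s ℚ.* s} {p} {ε} (ℚ.≤-<-trans
      (subst (s ℚ.* s ℚ.≤_) (⁺-nonNeg 0≤p) (√-approx-lower p n))
      (subst (ℚ._< p ℚ.+ ε) (ℚ.+-identityʳ p) (ℚ.+-monoʳ-< p 0<ε))))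
    (subst (ℚ._< ε) (sym (neg-sub (s ℚ.* s) p)) (p<q+ε⇒p-q<ε {p} {s ℚ.* s} {ε}
      (ℚ.<-trans (subst₂ ℚ._<_ (⁺-nonNeg 0≤p) (expand s t) (√-approx-upper p n))
        (ℚ.+-monoʳ-< (s ℚ.* s) (ℚ.≤-<-trans gap (half< 0<ε))))))
    where
    s = √-approx p n
    t = (+ 1) ℚ./ suc n
    open ℚ-Solver
    expand : ∀ s t → (s ℚ.+ t) ℚ.* (s ℚ.+ t) ≡ s ℚ.* s ℚ.+ (s ℚ.+ s ℚ.+ t) ℚ.* t
    expand = solve 2 (λ s t → (s :+ t) :* (s :+ t) := s :* s :+ (s :+ s :+ t) :* t) refl
    0≤s = √-approx-nonNeg p n
    0≤t = 0≤i/n 1 (suc n)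
    gap : (s ℚ.+ s ℚ.+ t) ℚ.* t ℚ.≤ ½ ℚ.* ε
    gap = subst ((s ℚ.+ s ℚ.+ t) ℚ.* t ℚ.≤_) eq
      (*-mono-≤ (ℚ.≤-trans (ℚ.+-mono-≤ (ℚ.+-mono-≤ 0≤s 0≤s) 0≤t) sum≤) 0≤t sum≤ t≤δ)
      where
      sum≤ : s ℚ.+ s ℚ.+ t ℚ.≤ B ℚ.+ B ℚ.+ 1ℚ
      sum≤ = ℚ.+-mono-≤ (ℚ.+-mono-≤ s≤B s≤B) t≤1

square-injective : ∀ {x y} → NonNegᴿ x → NonNegᴿ y → x *ᴿ x ≈ y *ᴿ y → x ≈ y
square-injective {x} {y} 0≤x 0≤y x²≈y² =
  ≈-trans (≈-sym (√[x*x]≈x {x} 0≤x)) (≈-trans (√-cong x²≈y²) (√[x*x]≈x {y} 0≤y))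

0≤p*p : ∀ p → 0ℚ ℚ.≤ p ℚ.* p
0≤p*p p with ℚ.≤-total 0ℚ p
... | inj₁ 0≤p = *-mono-≤ 0≤p ℚ.≤-refl 0≤p 0≤p
... | inj₂ p≤0 = subst (0ℚ ℚ.≤_) (lem p) (*-mono-≤ 0≤-p ℚ.≤-refl 0≤-p 0≤-p)
  where
  0≤-p : 0ℚ ℚ.≤ ℚ.- p
  0≤-p = ℚ.neg-antimono-≤ p≤0
  open ℚ-Solver
  lem : ∀ p → ℚ.- p ℚ.* ℚ.- p ≡ p ℚ.* p
  lem = solve 1 (λ p → :- p :* :- p := p :* p) refl

∣x∣*∣x∣≈x*x : ∀ x → ∣ x ∣ᴿ *ᴿ ∣ x ∣ᴿ ≈ x *ᴿ x
∣x∣*∣x∣≈x*x x = pointwise λ n →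
  trans (sym (ℚ.∣p*q∣≡∣p∣*∣q∣ (seq x n) (seq x n))) (ℚ.0≤p⇒∣p∣≡p (0≤p*p (seq x n)))

fromℚ-injective : ∀ {p q} → fromℚ p ≈ fromℚ q → p ≡ q
fromℚ-injective {p} {q} [ p≃q ] with p ℚ.≟ q
... | yes p≡q = p≡q
-- Taking ε to be the distance itself contradicts the strict inequality, since both sequences are
-- constant.
... | no  p≢q = let N , f = p≃q ℚ.∣ p ℚ.- q ∣ 0<∣p-q∣ in
  contradiction (f N ℕ.≤-refl) (ℚ.<-irrefl refl)
  where
  0<∣p-q∣ : 0ℚ ℚ.< ℚ.∣ p ℚ.- q ∣
  0<∣p-q∣ = ℚ.≰⇒> λ ∣p-q∣≤0 → p≢q (begin
    p                     ≡⟨ p-q+q≡p p q ⟨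
    (p ℚ.- q) ℚ.+ q       ≡⟨ cong (ℚ._+ q) 
      (ℚ.∣p∣≡0⇒p≡0 (p ℚ.- q) (ℚ.≤-antisym ∣p-q∣≤0 (ℚ.0≤∣p∣ (p ℚ.- q)))) ⟩
    0ℚ ℚ.+ q              ≡⟨ ℚ.+-identityˡ q ⟩
    q                     ∎)
    where open ≡-Reasoning

toℚ-injective : ∀ {i j} → toℚ i ≡ toℚ j → i ≡ j
toℚ-injective {i} {j} eq with ℤ.<-cmp i j
... | tri< i<j _ _ = contradiction (toℚ-mono-< i<j) (ℚ.<-irrefl eq)
... | tri≈ _ i≡j _ = i≡j
... | tri> _ _ j<i = contradiction (toℚ-mono-< j<i) (ℚ.<-irrefl (sym eq))

toℚ-‿- : ∀ i j → toℚ (i - j) ≡ toℚ i ℚ.- toℚ j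
toℚ-‿- i j = begin
  toℚ (i - j)                            ≡⟨ cancel (toℚ (i - j)) (toℚ j) ⟩
  (toℚ (i - j) ℚ.+ toℚ j) ℚ.- toℚ j      ≡⟨ cong (ℚ._- toℚ j) (toℚ-+ (i - j) j) ⟩
  toℚ (i - j + j) ℚ.- toℚ j              ≡⟨ cong (λ k → toℚ k ℚ.- toℚ j) (restore i j) ⟩
  toℚ i ℚ.- toℚ j                        ∎
  where
  open ≡-Reasoning
  open ℚ-Solver using (solve; _:=_; _:+_; _:-_)
  restore : ∀ i j → i - j + j ≡ i
  restore = solve-∀
  cancel : ∀ p q → p ≡ (p ℚ.+ q) ℚ.- q
  cancel = solve 2 (λ p q → p := (p :+ q) :- q) refl

√3-nonNeg : NonNegᴿ √3
√3-nonNeg n = √-approx-nonNeg (toℚ (+ 3)) n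

√3*√3≈3 : √3 *ᴿ √3 ≈ fromℤ (+ 3)
√3*√3≈3 = √x*√x≈x {fromℤ (+ 3)} λ _ → toℚ-nonNeg 3

-- Lattice vectors and parallelograms

infix 4 _≈ᶜ_

_≈ᶜ_ : ℂ → ℂ → Set
z ≈ᶜ w = re z ≈ re w × im z ≈ im w

≃ᶜ⇒≈ᶜ : ∀ {z w} → z ≃ᶜ w → z ≈ᶜ w
≃ᶜ⇒≈ᶜ (p , q) = [ p ] , [ q ]

≈ᶜ-trans : ∀ {z w t} → z ≈ᶜ w → w ≈ᶜ t → z ≈ᶜ t
≈ᶜ-trans (p , q) (p′ , q′) = ≈-trans p p′ , ≈-trans q q′

≈ᶜ-sym : ∀ {z w} → z ≈ᶜ w → w ≈ᶜ z
≈ᶜ-sym (p , q) = ≈-sym p , ≈-sym q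

-ᶜ-cong : ∀ {z z′ w w′} → z ≈ᶜ z′ → w ≈ᶜ w′ → z -ᶜ w ≈ᶜ z′ -ᶜ w′
-ᶜ-cong (p , q) (p′ , q′) = +ᴿ-cong p (-ᴿ-cong p′) , +ᴿ-cong q (-ᴿ-cong q′)

normSq : ℂ → ℝ
normSq z = re z *ᴿ re z +ᴿ im z *ᴿ im z

normSq-cong : ∀ {z w} → z ≈ᶜ w → normSq z ≈ normSq w
normSq-cong (p , q) = +ᴿ-cong (*ᴿ-cong p p) (*ᴿ-cong q q)

normSq-nonNeg : ∀ z → NonNegᴿ (normSq z)
normSq-nonNeg z n = ℚ.+-mono-≤ (0≤p*p (seq (re z) n)) (0≤p*p (seq (im z) n))

normSq-swap : ∀ z w → normSq (z -ᶜ w) ≈ normSq (w -ᶜ z)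
normSq-swap z w = pointwise λ n → lem (seq (re z) n) (seq (im z) n) (seq (re w) n) (seq (im w) n)
  where
  open ℚ-Solver
  lem : ∀ a b c d → (a ℚ.- c) ℚ.* (a ℚ.- c) ℚ.+ (b ℚ.- d) ℚ.* (b ℚ.- d) ≡
                    (c ℚ.- a) ℚ.* (c ℚ.- a) ℚ.+ (d ℚ.- b) ℚ.* (d ℚ.- b)
  lem = solve 4 (λ a b c d → (a :- c) :* (a :- c) :+ (b :- d) :* (b :- d) :=
                             (c :- a) :* (c :- a) :+ (d :- b) :* (d :- b)) refl

det-cong : ∀ {z z′ w w′} → z ≈ᶜ z′ → w ≈ᶜ w′ → det z w ≈ det z′ w′
det-cong (p , q) (p′ , q′) = +ᴿ-cong (*ᴿ-cong p q′) (-ᴿ-cong (*ᴿ-cong q p′))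

-- Spelled exactly as in `_∈ℤ[ω]`, so that membership of a lattice point is reflexivity.
lattice : 𝔼 → ℂ
lattice ⟨ m , n ⟩ = fromℤᶜ m +ᶜ fromℤᶜ n *ᶜ ω

lattice-sub : ∀ u v → lattice u -ᶜ lattice v ≈ᶜ lattice (u ⊕ ⊝ v)
lattice-sub ⟨ a , b ⟩ ⟨ c , d ⟩ =
  pointwise (λ n → trans (lem₁ (toℚ a) (toℚ b) (toℚ c) (toℚ d) (seq √3 n))
    (sym (cong₂ (λ p q → p ℚ.+ (q ℚ.* ℚ.-½ ℚ.- 0ℚ ℚ.* (½ ℚ.* seq √3 n))) (toℚ-‿- a c) (toℚ-‿- b d)))) ,
  pointwise (λ n → trans (lem₂ (toℚ b) (toℚ d) (seq √3 n))
    (sym (cong (λ q → 0ℚ ℚ.+ (q ℚ.* (½ ℚ.* seq √3 n) ℚ.+ 0ℚ ℚ.* ℚ.-½)) (toℚ-‿- b d))))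
  where
  open ℚ-Solver
  lem₁ : ∀ a b c d s →
    (a ℚ.+ (b ℚ.* ℚ.-½ ℚ.- 0ℚ ℚ.* (½ ℚ.* s))) ℚ.- (c ℚ.+ (d ℚ.* ℚ.-½ ℚ.- 0ℚ ℚ.* (½ ℚ.* s))) ≡
    (a ℚ.- c) ℚ.+ ((b ℚ.- d) ℚ.* ℚ.-½ ℚ.- 0ℚ ℚ.* (½ ℚ.* s))
  lem₁ = solve 5 (λ a b c d s →
    (a :+ (b :* con ℚ.-½ :- con 0ℚ :* (con ½ :* s))) :- (c :+ (d :* con ℚ.-½ :- con 0ℚ :* (con ½ :* s))) :=
    (a :- c) :+ ((b :- d) :* con ℚ.-½ :- con 0ℚ :* (con ½ :* s))) refl
  lem₂ : ∀ b d s →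
    (0ℚ ℚ.+ (b ℚ.* (½ ℚ.* s) ℚ.+ 0ℚ ℚ.* ℚ.-½)) ℚ.- (0ℚ ℚ.+ (d ℚ.* (½ ℚ.* s) ℚ.+ 0ℚ ℚ.* ℚ.-½)) ≡
    0ℚ ℚ.+ ((b ℚ.- d) ℚ.* (½ ℚ.* s) ℚ.+ 0ℚ ℚ.* ℚ.-½)
  lem₂ = solve 3 (λ b d s →
    (con 0ℚ :+ (b :* (con ½ :* s) :+ con 0ℚ :* con ℚ.-½)) :- (con 0ℚ :+ (d :* (con ½ :* s) :+ con 0ℚ :* con ℚ.-½)) :=
    con 0ℚ :+ ((b :- d) :* (con ½ :* s) :+ con 0ℚ :* con ℚ.-½)) refl

toℚ-norm : ∀ m n → toℚ (norm ⟨ m , n ⟩) ≡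
  toℚ m ℚ.* toℚ m ℚ.- toℚ m ℚ.* toℚ n ℚ.+ toℚ n ℚ.* toℚ n
toℚ-norm m n = begin
  toℚ (m * m - m * n + n * n)                   ≡⟨ toℚ-+ (m * m - m * n) (n * n) ⟨
  toℚ (m * m - m * n) ℚ.+ toℚ (n * n)           ≡⟨ cong (ℚ._+ toℚ (n * n)) (toℚ-‿- (m * m) (m * n)) ⟩
  toℚ (m * m) ℚ.- toℚ (m * n) ℚ.+ toℚ (n * n)
    ≡⟨ cong₂ ℚ._+_ (cong₂ ℚ._-_ (toℚ-* m m) (toℚ-* m n)) (toℚ-* n n) ⟨
  toℚ m ℚ.* toℚ m ℚ.- toℚ m ℚ.* toℚ n ℚ.+ toℚ n ℚ.* toℚ n ∎
  where open ≡-Reasoning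

-- Term by term, with the approximation to √3 as an indeterminate s, the squared modulus is (m -
-- n/2)² + (n/2)² s². This is an exact rational identity; only the replacement of s² by 3 is an
-- equality of limits.
normSq-lattice : ∀ u → normSq (lattice u) ≈ fromℤ (norm u)
normSq-lattice u@(⟨ m , n ⟩) = begin
  normSq (lattice u)
    ≈⟨ pointwise (λ k → lem₁ M N (seq √3 k)) ⟩
  fromℚ ((M ℚ.- ½ ℚ.* N) ℚ.* (M ℚ.- ½ ℚ.* N)) +ᴿ fromℚ (½ ℚ.* N ℚ.* (½ ℚ.* N)) *ᴿ (√3 *ᴿ √3)
    ≈⟨ +ᴿ-cong (≈-refl {fromℚ ((M ℚ.- ½ ℚ.* N) ℚ.* (M ℚ.- ½ ℚ.* N))})
         (*ᴿ-cong (≈-refl {fromℚ (½ ℚ.* N ℚ.* (½ ℚ.* N))}) √3*√3≈3) ⟩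
  fromℚ ((M ℚ.- ½ ℚ.* N) ℚ.* (M ℚ.- ½ ℚ.* N)) +ᴿ fromℚ (½ ℚ.* N ℚ.* (½ ℚ.* N)) *ᴿ fromℤ (+ 3)
    ≈⟨ pointwise (λ k → trans (lem₂ M N) (sym (toℚ-norm m n))) ⟩
  fromℤ (norm u) ∎
  where
  open ≈-Reasoning
  M = toℚ m
  N = toℚ n
  open ℚ-Solver using (solve; _:=_; _:+_; _:-_; _:*_; con)
  lem₁ : ∀ m n s →
    let x = m ℚ.+ (n ℚ.* ℚ.-½ ℚ.- 0ℚ ℚ.* (½ ℚ.* s))
        y = 0ℚ ℚ.+ (n ℚ.* (½ ℚ.* s) ℚ.+ 0ℚ ℚ.* ℚ.-½) in
    x ℚ.* x ℚ.+ y ℚ.* y ≡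
    (m ℚ.- ½ ℚ.* n) ℚ.* (m ℚ.- ½ ℚ.* n) ℚ.+ ½ ℚ.* n ℚ.* (½ ℚ.* n) ℚ.* (s ℚ.* s)
  lem₁ = solve 3 (λ m n s →
    let x = m :+ (n :* con ℚ.-½ :- con 0ℚ :* (con ½ :* s))
        y = con 0ℚ :+ (n :* (con ½ :* s) :+ con 0ℚ :* con ℚ.-½) in
    x :* x :+ y :* y :=
    (m :- con ½ :* n) :* (m :- con ½ :* n) :+ con ½ :* n :* (con ½ :* n) :* (s :* s)) refl
  lem₂ : ∀ m n →
    (m ℚ.- ½ ℚ.* n) ℚ.* (m ℚ.- ½ ℚ.* n) ℚ.+ ½ ℚ.* n ℚ.* (½ ℚ.* n) ℚ.* toℚ (+ 3) ≡
    m ℚ.* m ℚ.- m ℚ.* n ℚ.+ n ℚ.* n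
  lem₂ = solve 2 (λ m n →
    (m :- con ½ :* n) :* (m :- con ½ :* n) :+ con ½ :* n :* (con ½ :* n) :* con (toℚ (+ 3)) :=
    m :* m :- m :* n :+ n :* n) refl

cross : 𝔼 → 𝔼 → ℤ
cross ⟨ a , b ⟩ ⟨ c , d ⟩ = a * d - b * c

toℚ-cross : ∀ a b c d → toℚ (cross ⟨ a , b ⟩ ⟨ c , d ⟩) ≡ toℚ a ℚ.* toℚ d ℚ.- toℚ b ℚ.* toℚ c
toℚ-cross a b c d = trans (toℚ-‿- (a * d) (b * c)) (sym (cong₂ ℚ._-_ (toℚ-* a d) (toℚ-* b c)))

4*[p/4] : ∀ p → toℚ (+ 4) ℚ.* (½ ℚ.* ½ ℚ.* p) ≡ p
4*[p/4] = solve 1 (λ p → con (toℚ (+ 4)) :* (con ½ :* con ½ :* p) := p) refl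
  where open ℚ-Solver

[4*p]/4 : ∀ p → ½ ℚ.* ½ ℚ.* (toℚ (+ 4) ℚ.* p) ≡ p
[4*p]/4 = solve 1 (λ p → con ½ :* con ½ :* (con (toℚ (+ 4)) :* p) := p) refl
  where open ℚ-Solver

-- The determinant is √3/2 times the integer cross product, since 1 and ω span area √3/2. Its square
-- 3/4 · cross² is rational.
det²-lattice : ∀ u v → det (lattice u) (lattice v) *ᴿ det (lattice u) (lattice v) ≈
  fromℚ (½ ℚ.* ½ ℚ.* toℚ (+ 3 * (cross u v * cross u v)))
det²-lattice u@(⟨ a , b ⟩) v@(⟨ c , d ⟩) = begin
  det (lattice u) (lattice v) *ᴿ det (lattice u) (lattice v)
    ≈⟨ pointwise (λ k → trans (lem₁ (toℚ a) (toℚ b) (toℚ c) (toℚ d) (seq √3 k))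
         (cong (λ p → ½ ℚ.* ½ ℚ.* (p ℚ.* p) ℚ.* (seq √3 k ℚ.* seq √3 k)) (sym (toℚ-cross a b c d)))) ⟩
  fromℚ (½ ℚ.* ½ ℚ.* (X ℚ.* X)) *ᴿ (√3 *ᴿ √3)
    ≈⟨ *ᴿ-cong (≈-refl {fromℚ (½ ℚ.* ½ ℚ.* (X ℚ.* X))}) √3*√3≈3 ⟩
  fromℚ (½ ℚ.* ½ ℚ.* (X ℚ.* X)) *ᴿ fromℤ (+ 3)
    ≈⟨ pointwise (λ _ → trans (lem₂ (X ℚ.* X)) (cong (½ ℚ.* ½ ℚ.*_)
         (trans (cong (toℚ (+ 3) ℚ.*_) (toℚ-* x x)) (toℚ-* (+ 3) (x * x))))) ⟩
  fromℚ (½ ℚ.* ½ ℚ.* toℚ (+ 3 * (x * x))) ∎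
  where
  open ≈-Reasoning
  x = cross u v
  X = toℚ x
  open ℚ-Solver using (solve; _:=_; _:+_; _:-_; _:*_; con)
  lem₁ : ∀ a b c d s →
    let x₁ = a ℚ.+ (b ℚ.* ℚ.-½ ℚ.- 0ℚ ℚ.* (½ ℚ.* s))
        y₁ = 0ℚ ℚ.+ (b ℚ.* (½ ℚ.* s) ℚ.+ 0ℚ ℚ.* ℚ.-½)
        x₂ = c ℚ.+ (d ℚ.* ℚ.-½ ℚ.- 0ℚ ℚ.* (½ ℚ.* s))
        y₂ = 0ℚ ℚ.+ (d ℚ.* (½ ℚ.* s) ℚ.+ 0ℚ ℚ.* ℚ.-½)
        e  = x₁ ℚ.* y₂ ℚ.- y₁ ℚ.* x₂
        p  = a ℚ.* d ℚ.- b ℚ.* c in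
    e ℚ.* e ≡ ½ ℚ.* ½ ℚ.* (p ℚ.* p) ℚ.* (s ℚ.* s)
  lem₁ = solve 5 (λ a b c d s →
    let x₁ = a :+ (b :* con ℚ.-½ :- con 0ℚ :* (con ½ :* s))
        y₁ = con 0ℚ :+ (b :* (con ½ :* s) :+ con 0ℚ :* con ℚ.-½)
        x₂ = c :+ (d :* con ℚ.-½ :- con 0ℚ :* (con ½ :* s))
        y₂ = con 0ℚ :+ (d :* (con ½ :* s) :+ con 0ℚ :* con ℚ.-½)
        e  = x₁ :* y₂ :- y₁ :* x₂
        p  = a :* d :- b :* c in
    e :* e := con ½ :* con ½ :* (p :* p) :* (s :* s)) refl
  lem₂ : ∀ p → ½ ℚ.* ½ ℚ.* p ℚ.* toℚ (+ 3) ≡ ½ ℚ.* ½ ℚ.* (toℚ (+ 3) ℚ.* p)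
  lem₂ = solve 1 (λ p → con ½ :* con ½ :* p :* con (toℚ (+ 3)) := con ½ :* con ½ :* (con (toℚ (+ 3)) :* p)) refl

[i√3]² : ∀ i → (fromℤ i *ᴿ √3) *ᴿ (fromℤ i *ᴿ √3) ≈ fromℤ (+ 3 * (i * i))
[i√3]² i = begin
  (fromℤ i *ᴿ √3) *ᴿ (fromℤ i *ᴿ √3)      ≈⟨ pointwise (λ k → lem (toℚ i) (seq √3 k)) ⟩
  (√3 *ᴿ √3) *ᴿ fromℚ (toℚ i ℚ.* toℚ i)   ≈⟨ *ᴿ-cong √3*√3≈3 (≈-refl {fromℚ (toℚ i ℚ.* toℚ i)}) ⟩
  fromℤ (+ 3) *ᴿ fromℚ (toℚ i ℚ.* toℚ i)
    ≈⟨ pointwise (λ _ → trans (cong (toℚ (+ 3) ℚ.*_) (toℚ-* i i)) (toℚ-* (+ 3) (i * i))) ⟩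
  fromℤ (+ 3 * (i * i))                   ∎
  where
  open ≈-Reasoning
  open ℚ-Solver using (solve; _:=_; _:*_)
  lem : ∀ i s → (i ℚ.* s) ℚ.* (i ℚ.* s) ≡ (s ℚ.* s) ℚ.* (i ℚ.* i)
  lem = solve 2 (λ i s → (i :* s) :* (i :* s) := (s :* s) :* (i :* i)) refl

n√3-nonNeg : ∀ n → NonNegᴿ (fromℤ (+ n) *ᴿ √3)
n√3-nonNeg n k = *-mono-≤ (toℚ-nonNeg n) ℚ.≤-refl (toℚ-nonNeg n) (√3-nonNeg k)

length⇒norm : ∀ {z u} n → z ≈ᶜ lattice u → √ normSq z ≈ fromℤ (+ n) *ᴿ √3 → norm u ≡ + 3 * (+ n * + n)
length⇒norm {z} {u} n z≈u ∣z∣≈n√3 = toℚ-injective (fromℚ-injective (begin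
  fromℤ (norm u)                                  ≈⟨ normSq-lattice u ⟨
  normSq (lattice u)                              ≈⟨ normSq-cong z≈u ⟨
  normSq z                                        ≈⟨ √x*√x≈x {normSq z} (normSq-nonNeg z) ⟨
  √ normSq z *ᴿ √ normSq z                        ≈⟨ *ᴿ-cong ∣z∣≈n√3 ∣z∣≈n√3 ⟩
  (fromℤ (+ n) *ᴿ √3) *ᴿ (fromℤ (+ n) *ᴿ √3)      ≈⟨ [i√3]² (+ n) ⟩
  fromℤ (+ 3 * (+ n * + n))                       ∎))
  where open ≈-Reasoning

norm⇒length : ∀ {z u} n → z ≈ᶜ lattice u → norm u ≡ + 3 * (+ n * + n) → √ normSq z ≈ fromℤ (+ n) *ᴿ √3
norm⇒length {z} {u} n z≈u norm-u≡ = begin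
  √ normSq z                                        ≈⟨ √-cong (normSq-cong z≈u) ⟩
  √ normSq (lattice u)                              ≈⟨ √-cong (normSq-lattice u) ⟩
  √ fromℤ (norm u)                                  ≡⟨ cong (λ i → √ fromℤ i) norm-u≡ ⟩
  √ fromℤ (+ 3 * (+ n * + n))                       ≈⟨ √-cong ([i√3]² (+ n)) ⟨
  √ ((fromℤ (+ n) *ᴿ √3) *ᴿ (fromℤ (+ n) *ᴿ √3))    ≈⟨ √[x*x]≈x {fromℤ (+ n) *ᴿ √3} (n√3-nonNeg n) ⟩
  fromℤ (+ n) *ᴿ √3                                 ∎
  where open ≈-Reasoning

module _ (P : Parallelogram) where
  open Parallelogram P

  -- Add `D -ᶜ B` to both sides of `AB≃DC`. This transfers the prescribed length of BC to the
  -- spanning vector AD.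
  AD≈BC : D -ᶜ A ≈ᶜ C -ᶜ B
  AD≈BC = shift (re A) (re B) (re C) (re D) (proj₁ AB≈DC) , shift (im A) (im B) (im C) (im D) (proj₂ AB≈DC)
    where
    AB≈DC : B -ᶜ A ≈ᶜ C -ᶜ D
    AB≈DC = ≃ᶜ⇒≈ᶜ AB≃DC
    open ℚ-Solver
    lem₁ : ∀ a b d → d ℚ.- a ≡ (b ℚ.- a) ℚ.+ (d ℚ.- b)
    lem₁ = solve 3 (λ a b d → d :- a := (b :- a) :+ (d :- b)) refl
    lem₂ : ∀ b c d → (c ℚ.- d) ℚ.+ (d ℚ.- b) ≡ c ℚ.- b
    lem₂ = solve 3 (λ b c d → (c :- d) :+ (d :- b) := c :- b) refl
    shift : ∀ a b c d → b -ᴿ a ≈ c -ᴿ d → d -ᴿ a ≈ c -ᴿ b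
    shift a b c d eq = ≈-trans (pointwise λ n → lem₁ (seq a n) (seq b n) (seq d n))
      (≈-trans (+ᴿ-cong eq (≈-refl {d -ᴿ b})) (pointwise λ n → lem₂ (seq b n) (seq c n) (seq d n)))

  CD≈AB : dist C D ≈ dist A B
  CD≈AB = √-cong (≈-trans (normSq-swap D C) (normSq-cong (≈ᶜ-sym (≃ᶜ⇒≈ᶜ AB≃DC))))

  DA≈BC : dist D A ≈ dist B C
  DA≈BC = √-cong (≈-trans (normSq-swap A D) (normSq-cong AD≈BC))

  perimeter-sides : ∀ a b → HasSideLengths P (fromℤ (+ a) *ᴿ √3) (fromℤ (+ b) *ᴿ √3) →
    perimeter P ≈ fromℤ (+ (2 ℕ.* (a ℕ.+ b))) *ᴿ √3
  perimeter-sides a b (AB≃ , BC≃) = begin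
    dist A B +ᴿ dist B C +ᴿ dist C D +ᴿ dist D A
      ≈⟨ +ᴿ-cong (+ᴿ-cong (+ᴿ-cong AB≈ BC≈) (≈-trans CD≈AB AB≈)) (≈-trans DA≈BC BC≈) ⟩
    ℓ a +ᴿ ℓ b +ᴿ ℓ a +ᴿ ℓ b
      ≈⟨ pointwise (λ k → trans (lem (toℚ (+ a)) (toℚ (+ b)) (seq √3 k))
           (cong (ℚ._* seq √3 k) (trans (cong (toℚ (+ 2) ℚ.*_) (toℚ-+ (+ a) (+ b))) (toℚ-*ℕ 2 (a ℕ.+ b))))) ⟩
    fromℤ (+ (2 ℕ.* (a ℕ.+ b))) *ᴿ √3 ∎
    where
    open ≈-Reasoning
    ℓ : ℕ → ℝ
    ℓ n = fromℤ (+ n) *ᴿ √3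
    AB≈ : dist A B ≈ ℓ a
    AB≈ = [ AB≃ ]
    BC≈ : dist B C ≈ ℓ b
    BC≈ = [ BC≃ ]
    open ℚ-Solver using (solve; _:=_; _:*_; _:+_; con)
    lem : ∀ a b s → a ℚ.* s ℚ.+ b ℚ.* s ℚ.+ a ℚ.* s ℚ.+ b ℚ.* s ≡ toℚ (+ 2) ℚ.* (a ℚ.+ b) ℚ.* s
    lem = solve 3 (λ a b s → a :* s :+ b :* s :+ a :* s :+ b :* s := con (toℚ (+ 2)) :* (a :+ b) :* s) refl

  area²-lattice : ∀ u v → B -ᶜ A ≈ᶜ lattice u → D -ᶜ A ≈ᶜ lattice v →
    area P *ᴿ area P ≈ fromℚ (½ ℚ.* ½ ℚ.* toℚ (+ 3 * (cross u v * cross u v)))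
  area²-lattice u v AB≈u AD≈v = ≈-trans (∣x∣*∣x∣≈x*x (det (B -ᶜ A) (D -ᶜ A)))
    (≈-trans (*ᴿ-cong det≈ det≈) (det²-lattice u v))
    where
    det≈ : det (B -ᶜ A) (D -ᶜ A) ≈ det (lattice u) (lattice v)
    det≈ = det-cong {B -ᶜ A} {lattice u} {D -ᶜ A} {lattice v} AB≈u AD≈v

  area-nonNeg : NonNegᴿ (area P)
  area-nonNeg n = ℚ.0≤∣p∣ (seq (det (B -ᶜ A) (D -ᶜ A)) n)

  -- Both sides of perimeter = area are nonnegative, so they may be compared
  -- through their squares, which are rational.
  module _ (a b : ℕ) (u v : 𝔼) (AB≈u : B -ᶜ A ≈ᶜ lattice u) (AD≈v : D -ᶜ A ≈ᶜ lattice v)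
           (sides : HasSideLengths P (fromℤ (+ a) *ᴿ √3) (fromℤ (+ b) *ᴿ √3)) where

    private
      n : ℕ
      n = 2 ℕ.* (a ℕ.+ b)

      δ : ℤ
      δ = cross u v

    -- The squared perimeter is 3n² and the squared area is 3/4 · δ²; clearing the 4 and the 3 gives
    -- the equation.
    equable⇒cross² : IsEquable P → δ * δ ≡ + 4 * (+ n * + n)
    equable⇒cross² eq = cancel (toℚ-injective (begin
      toℚ (+ 3 * (δ * δ))                               ≡⟨ 4*[p/4] (toℚ (+ 3 * (δ * δ))) ⟨
      toℚ (+ 4) ℚ.* (½ ℚ.* ½ ℚ.* toℚ (+ 3 * (δ * δ)))    ≡⟨ cong (toℚ (+ 4) ℚ.*_) (fromℚ-injective squares) ⟨
      toℚ (+ 4) ℚ.* toℚ (+ 3 * (+ n * + n))             ≡⟨ toℚ-* (+ 4) (+ 3 * (+ n * + n)) ⟩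
      toℚ (+ 4 * (+ 3 * (+ n * + n)))                   ∎))
      where
      open ≡-Reasoning
      P≈A : perimeter P ≈ area P
      P≈A = [ eq ]
      ℓ≈A : fromℤ (+ n) *ᴿ √3 ≈ area P
      ℓ≈A = ≈-trans (≈-sym (perimeter-sides a b sides)) P≈A
      squares : fromℤ (+ 3 * (+ n * + n)) ≈ fromℚ (½ ℚ.* ½ ℚ.* toℚ (+ 3 * (δ * δ)))
      squares = ≈-trans (≈-sym ([i√3]² (+ n))) (≈-trans (*ᴿ-cong ℓ≈A ℓ≈A) (area²-lattice u v AB≈u AD≈v))
      lem : ∀ m → + 4 * (+ 3 * m) ≡ + 3 * (+ 4 * m)
      lem = solve-∀
      cancel : + 3 * (δ * δ) ≡ + 4 * (+ 3 * (+ n * + n)) → δ * δ ≡ + 4 * (+ n * + n)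
      cancel eq = ℤ.*-cancelˡ-≡ (+ 3) (δ * δ) (+ 4 * (+ n * + n)) (trans eq (lem (+ n * + n)))

    cross²⇒equable : δ * δ ≡ + 4 * (+ n * + n) → IsEquable P
    cross²⇒equable δ²≡ = ≈⇒≃ (≈-trans (perimeter-sides a b sides)
      (square-injective {fromℤ (+ n) *ᴿ √3} {area P} (n√3-nonNeg n) area-nonNeg
        (≈-trans ([i√3]² (+ n)) (≈-trans (pointwise (λ _ → scaled)) (≈-sym (area²-lattice u v AB≈u AD≈v))))))
      where
      lem : ∀ m → + 4 * (+ 3 * m) ≡ + 3 * (+ 4 * m)
      lem = solve-∀
      scaled : toℚ (+ 3 * (+ n * + n)) ≡ ½ ℚ.* ½ ℚ.* toℚ (+ 3 * (δ * δ))
      scaled = trans (sym ([4*p]/4 (toℚ (+ 3 * (+ n * + n))))) (cong (½ ℚ.* ½ ℚ.*_)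
        (trans (toℚ-* (+ 4) (+ 3 * (+ n * + n))) (cong toℚ
          (trans (lem (+ n * + n)) (cong (+ 3 *_) (sym δ²≡))))))

-- A vanishing determinant would have square 3/4 · cross² equal to the rational 0.
det≄0 : ∀ {z w} u v → z ≈ᶜ lattice u → w ≈ᶜ lattice v → cross u v * cross u v ≢ 0ℤ → ¬ (det z w ≃ 0ℝ)
det≄0 {z} {w} u v z≈u w≈v δ²≢0 det≃0 = δ²≢0 (ℤ.*-cancelˡ-≡ (+ 3) (δ * δ) 0ℤ (toℚ-injective (begin
  toℚ (+ 3 * (δ * δ))                             ≡⟨ 4*[p/4] (toℚ (+ 3 * (δ * δ))) ⟨
  toℚ (+ 4) ℚ.* (½ ℚ.* ½ ℚ.* toℚ (+ 3 * (δ * δ))) ≡⟨ cong (toℚ (+ 4) ℚ.*_) (fromℚ-injective quarter≈0) ⟩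
  0ℚ                                              ∎)))
  where
  open ≡-Reasoning
  δ = cross u v
  det≈ : det z w ≈ det (lattice u) (lattice v)
  det≈ = det-cong {z} {lattice u} {w} {lattice v} z≈u w≈v
  det≈0 : det z w ≈ 0ℝ
  det≈0 = [ det≃0 ]
  quarter≈0 : fromℚ (½ ℚ.* ½ ℚ.* toℚ (+ 3 * (δ * δ))) ≈ fromℚ (0ℚ ℚ.* 0ℚ)
  quarter≈0 = ≈-trans (≈-sym (det²-lattice u v))
    (≈-trans (*ᴿ-cong (≈-sym det≈) (≈-sym det≈)) (≈-trans (*ᴿ-cong det≈0 det≈0) (pointwise λ _ → refl)))

lattice-∈ : ∀ u → lattice u ∈ℤ[ω]
lattice-∈ ⟨ m , n ⟩ = m , n , ≈⇒≃ (≈-refl {re (lattice ⟨ m , n ⟩)}) , ≈⇒≃ (≈-refl {im (lattice ⟨ m , n ⟩)})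

∈⇒lattice : ∀ {z} → z ∈ℤ[ω] → ∃[ u ] z ≈ᶜ lattice u
∈⇒lattice (m , n , eq) = ⟨ m , n ⟩ , ≃ᶜ⇒≈ᶜ eq

lattice-vector : ∀ {z w} u v → z ≈ᶜ lattice u → w ≈ᶜ lattice v → z -ᶜ w ≈ᶜ lattice (u ⊕ ⊝ v)
lattice-vector {z} {w} u v z≈u w≈v =
  ≈ᶜ-trans {z -ᶜ w} {lattice u -ᶜ lattice v} {lattice (u ⊕ ⊝ v)}
    (-ᶜ-cong {z} {lattice u} {w} {lattice v} z≈u w≈v) (lattice-sub u v)

⊝0-identityʳ : ∀ z → z ⊕ ⊝ 0ᴱ ≡ z
⊝0-identityʳ ⟨ x , y ⟩ = cong₂ ⟨_,_⟩ (ℤ.+-identityʳ x) (ℤ.+-identityʳ y)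

from-origin : ∀ u → lattice u -ᶜ lattice 0ᴱ ≈ᶜ lattice u
from-origin u = subst (λ v → lattice u -ᶜ lattice 0ᴱ ≈ᶜ lattice v) (⊝0-identityʳ u) (lattice-sub u 0ᴱ)

z⊕w⊝w≡z : ∀ z w → z ⊕ w ⊕ ⊝ w ≡ z
z⊕w⊝w≡z ⟨ x , y ⟩ ⟨ u , v ⟩ = cong₂ ⟨_,_⟩ (lem x u) (lem y v)
  where
  lem : ∀ i j → i + j - j ≡ i
  lem = solve-∀

lattice-parallelogram : ∀ u v → cross u v * cross u v ≢ 0ℤ → Parallelogram
lattice-parallelogram u v δ²≢0 = record
  { A = lattice 0ᴱ
  ; B = lattice u
  ; C = lattice (u ⊕ v)
  ; D = lattice v
  ; AB≃DC = ≈⇒≃ (proj₁ AB≈DC) , ≈⇒≃ (proj₂ AB≈DC)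
  ; nondegenerate = det≄0 u v (from-origin u) (from-origin v) δ²≢0
  }
  where
  AB≈DC : lattice u -ᶜ lattice 0ᴱ ≈ᶜ lattice (u ⊕ v) -ᶜ lattice v
  AB≈DC = ≈ᶜ-trans {lattice u -ᶜ lattice 0ᴱ} {lattice u} {lattice (u ⊕ v) -ᶜ lattice v} (from-origin u)
    (≈ᶜ-sym {lattice (u ⊕ v) -ᶜ lattice v} {lattice u}
      (subst (λ t → lattice (u ⊕ v) -ᶜ lattice v ≈ᶜ lattice t) (z⊕w⊝w≡z u v) (lattice-sub (u ⊕ v) v)))

-- The arithmetic of the discriminant

prime∣square : ∀ {p} → Prime p → ∀ i m → i * i ≡ + p * m → ∃[ j ] i ≡ + p * j
prime∣square {p} p-prime i m i²≡pm = let ℤ∣.divides j i≡jp = ℤ∣.∣ᵤ⇒∣ {+ p} {i} p∣∣i∣ in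
  j , trans i≡jp (ℤ.*-comm j (+ p))
  where
  p∣∣i∣² : p ℕ.∣ ∣ i ∣ ℕ.* ∣ i ∣
  p∣∣i∣² = subst (p ℕ.∣_) (trans (sym (ℤ.abs-* (+ p) m)) (trans (cong ∣_∣ (sym i²≡pm)) (ℤ.abs-* i i)))
    (ℕ.m∣m*n ∣ m ∣)
  p∣∣i∣ : p ℕ.∣ ∣ i ∣
  p∣∣i∣ = reduce (euclidsLemma ∣ i ∣ ∣ i ∣ p-prime p∣∣i∣²)

prime[3] : Prime 3
prime[3] = from-yes (prime? 3)

disc : ℤ → ℤ → ℤ
disc a b = + 9 * (a * a) * (b * b) - + 12 * ((a + b) * (a + b))

-- 4 |u|² |v|² is the square of twice the inner product plus three times the
-- square of the cross product.
lattice⇒square : ∀ u v a b → norm u ≡ + 3 * (a * a) → norm v ≡ + 3 * (b * b) →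
  cross u v * cross u v ≡ + 4 * ((+ 2 * (a + b)) * (+ 2 * (a + b))) → ∃[ k ] disc a b ≡ k * k
lattice⇒square ⟨ p , q ⟩ ⟨ r , s ⟩ a b norm-u norm-v δ² =
  -- The inner product m/2 is a priori only a half-integer; m² = 4 `disc a b` forces `m` to be even.
  half (prime∣square prime[2] m (+ 2 * disc a b) (trans m² (lem₃ (disc a b))))
  where
  open ≡-Reasoning
  m = + 2 * (p * r) + + 2 * (q * s) - p * s - q * r
  lem₁ : ∀ p q r s → let m = + 2 * (p * r) + + 2 * (q * s) - p * s - q * r; δ = p * s - q * r in
    m * m ≡ + 4 * ((p * p - p * q + q * q) * (r * r - r * s + s * s)) - + 3 * (δ * δ)
  lem₁ = solve-∀
  lem₂ : ∀ a b → + 4 * ((+ 3 * (a * a)) * (+ 3 * (b * b))) - + 3 * (+ 4 * ((+ 2 * (a + b)) * (+ 2 * (a + b)))) ≡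
    + 4 * (+ 9 * (a * a) * (b * b) - + 12 * ((a + b) * (a + b)))
  lem₂ = solve-∀
  lem₃ : ∀ d → + 4 * d ≡ + 2 * (+ 2 * d)
  lem₃ = solve-∀
  m² : m * m ≡ + 4 * disc a b
  m² = begin
    m * m ≡⟨ lem₁ p q r s ⟩
    + 4 * (norm ⟨ p , q ⟩ * norm ⟨ r , s ⟩) - + 3 * (cross ⟨ p , q ⟩ ⟨ r , s ⟩ * cross ⟨ p , q ⟩ ⟨ r , s ⟩)
      ≡⟨ cong₂ (λ i j → + 4 * i - + 3 * j) (cong₂ _*_ norm-u norm-v) δ² ⟩
    + 4 * ((+ 3 * (a * a)) * (+ 3 * (b * b))) - + 3 * (+ 4 * ((+ 2 * (a + b)) * (+ 2 * (a + b))))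
      ≡⟨ lem₂ a b ⟩
    + 4 * disc a b ∎
  lem₄ : ∀ k → (+ 2 * k) * (+ 2 * k) ≡ + 4 * (k * k)
  lem₄ = solve-∀
  half : ∃[ k ] m ≡ + 2 * k → ∃[ k ] disc a b ≡ k * k
  half (k , m≡2k) = k , ℤ.*-cancelˡ-≡ (+ 4) (disc a b) (k * k) (begin
    + 4 * disc a b         ≡⟨ m² ⟨
    m * m                  ≡⟨ cong (λ m → m * m) m≡2k ⟩
    (+ 2 * k) * (+ 2 * k)  ≡⟨ lem₄ k ⟩
    + 4 * (k * k)          ∎)

-- Both coefficients 9 and 12 are multiples of 3, so 3 divides k² and then `k`. Now k² is a multiple
-- of 9, which forces 3 to divide (a + b)² as well.
divide-by-3 : ∀ a b k → disc a b ≡ k * k →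
  ∃[ l ] ∃[ c ] a + b ≡ + 3 * c × l * l + + 12 * (c * c) ≡ (a * a) * (b * b)
divide-by-3 a b k disc≡k² =
  let l , k≡3l   = prime∣square prime[3] k _ (trans (sym disc≡k²) (lem₁ a b))
      c , a+b≡3c = prime∣square prime[3] (a + b) _ (second l k≡3l)
  in l , c , a+b≡3c , third l c k≡3l a+b≡3c
  where
  open ≡-Reasoning
  lem₁ : ∀ a b → + 9 * (a * a) * (b * b) - + 12 * ((a + b) * (a + b)) ≡
    + 3 * (+ 3 * (a * a) * (b * b) - + 4 * ((a + b) * (a + b)))
  lem₁ = solve-∀
  9l²≡ : ∀ l → k ≡ + 3 * l → (+ 3 * l) * (+ 3 * l) ≡ disc a b
  9l²≡ l k≡3l = trans (cong (λ k → k * k) (sym k≡3l)) (sym disc≡k²)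
  -- Splitting 12 as 3 + 9 isolates 3 (a + b)² against multiples of 9, so that cancelling a single 3
  -- suffices.
  lem₂ : ∀ a b → + 3 * ((a + b) * (a + b)) ≡
    + 9 * (a * a) * (b * b) - (+ 9 * (a * a) * (b * b) - + 12 * ((a + b) * (a + b))) - + 9 * ((a + b) * (a + b))
  lem₂ = solve-∀
  lem₃ : ∀ a b l → + 9 * (a * a) * (b * b) - (+ 3 * l) * (+ 3 * l) - + 9 * ((a + b) * (a + b)) ≡
    + 3 * (+ 3 * ((a * a) * (b * b) - l * l - (a + b) * (a + b)))
  lem₃ = solve-∀
  second : ∀ l → k ≡ + 3 * l → (a + b) * (a + b) ≡ + 3 * ((a * a) * (b * b) - l * l - (a + b) * (a + b))
  second l k≡3l = ℤ.*-cancelˡ-≡ (+ 3) ((a + b) * (a + b)) _ (begin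
    + 3 * ((a + b) * (a + b)) ≡⟨ lem₂ a b ⟩
    + 9 * (a * a) * (b * b) - disc a b - + 9 * ((a + b) * (a + b))
      ≡⟨ cong (λ i → + 9 * (a * a) * (b * b) - i - + 9 * ((a + b) * (a + b))) (9l²≡ l k≡3l) ⟨
    + 9 * (a * a) * (b * b) - (+ 3 * l) * (+ 3 * l) - + 9 * ((a + b) * (a + b)) ≡⟨ lem₃ a b l ⟩
    + 3 * (+ 3 * ((a * a) * (b * b) - l * l - (a + b) * (a + b))) ∎)
  lem₄ : ∀ l c → + 9 * (l * l + + 12 * (c * c)) ≡ (+ 3 * l) * (+ 3 * l) + + 12 * ((+ 3 * c) * (+ 3 * c))
  lem₄ = solve-∀
  lem₅ : ∀ a b s → + 9 * (a * a) * (b * b) - s + s ≡ + 9 * ((a * a) * (b * b))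
  lem₅ = solve-∀
  third : ∀ l c → k ≡ + 3 * l → a + b ≡ + 3 * c → l * l + + 12 * (c * c) ≡ (a * a) * (b * b)
  third l c k≡3l a+b≡3c = ℤ.*-cancelˡ-≡ (+ 9) (l * l + + 12 * (c * c)) ((a * a) * (b * b)) (begin
    + 9 * (l * l + + 12 * (c * c)) ≡⟨ lem₄ l c ⟩
    (+ 3 * l) * (+ 3 * l) + + 12 * ((+ 3 * c) * (+ 3 * c))
      ≡⟨ cong₂ (λ i j → i + + 12 * (j * j)) (9l²≡ l k≡3l) (sym a+b≡3c) ⟩
    disc a b + + 12 * ((a + b) * (a + b)) ≡⟨ lem₅ a b (+ 12 * ((a + b) * (a + b))) ⟩
    + 9 * ((a * a) * (b * b)) ∎)

-- 1 + 2ω = i√3, of norm 3.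
√-3 : 𝔼
√-3 = ⟨ + 1 , + 2 ⟩

-- The cross product of x and y is the ω-coefficient of x̄ y. For √-3 u and √-3 v̄ this product is 3
-- times the conjugate of u v, and conjugation negates the ω-coefficient.
cross-scaled : ∀ u v → cross (√-3 ⊗ u) (√-3 ⊗ conj v) ≡ - (+ 3 * 𝔼.ω-coeff (u ⊗ v))
cross-scaled ⟨ p , q ⟩ ⟨ r , s ⟩ = lem p q r s
  where
  lem : ∀ p q r s → let r′ = r - s; s′ = - s in
    (+ 1 * p - + 2 * q) * (+ 1 * s′ + + 2 * r′ - + 2 * s′) - (+ 1 * q + + 2 * p - + 2 * q) * (+ 1 * r′ - + 2 * s′) ≡
    - (+ 3 * (p * s + q * r - q * s))
  lem = solve-∀

norm-√-3⊗ : ∀ u n → ‖ u ‖ ≡ n ℕ.* n → norm (√-3 ⊗ u) ≡ + 3 * (+ n * + n)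
norm-√-3⊗ u n eq = trans (norm-⊗ √-3 u) (cong (+ 3 *_)
  (trans (sym (+‖‖≡norm u)) (trans (cong +_ eq) (ℤ.pos-* n n))))

‖conj‖ : ∀ u → ‖ conj u ‖ ≡ ‖ u ‖
‖conj‖ u = cong ∣_∣ (norm-conj u)

square⇒lattice : ∀ a b .{{_ : NonZero a}} k → disc (+ a) (+ b) ≡ k * k →
  ∃[ u ] ∃[ v ] norm u ≡ + 3 * (+ a * + a) × norm v ≡ + 3 * (+ b * + b) ×
    cross u v * cross u v ≡ + 4 * ((+ 2 * (+ a + + b)) * (+ 2 * (+ a + + b)))
square⇒lattice a b k disc≡k² =
  let l , c , a+b≡3c , l²+12c² = divide-by-3 (+ a) (+ b) k disc≡k²
      -- These are the coordinates of l + 2c√-3, as √-3 = 1 + 2ω. The ω-coefficient 4c makes the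
      -- cross product -3 · 4c = -4 (a + b).
      u , v , z≡uv , ‖u‖≡ , ‖v‖≡ = split-norm a b ⟨ l + + 2 * c , + 4 * c ⟩ (norm-z l c l²+12c²)
  in √-3 ⊗ u , √-3 ⊗ conj v , norm-√-3⊗ u a ‖u‖≡ , norm-√-3⊗ (conj v) b (trans (‖conj‖ v) ‖v‖≡) ,
     cross² u v l c z≡uv a+b≡3c
  where
  open ≡-Reasoning
  lem₁ : ∀ l c → let x = l + + 2 * c; y = + 4 * c in x * x - x * y + y * y ≡ l * l + + 12 * (c * c)
  lem₁ = solve-∀
  norm-z : ∀ l c → l * l + + 12 * (c * c) ≡ (+ a * + a) * (+ b * + b) →
    ‖ ⟨ l + + 2 * c , + 4 * c ⟩ ‖ ≡ a ℕ.* a ℕ.* (b ℕ.* b)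
  norm-z l c eq = begin
    ‖ ⟨ l + + 2 * c , + 4 * c ⟩ ‖     ≡⟨ cong ∣_∣ (trans (lem₁ l c) eq) ⟩
    ∣ (+ a * + a) * (+ b * + b) ∣     ≡⟨ ℤ.abs-* (+ a * + a) (+ b * + b) ⟩
    ∣ + a * + a ∣ ℕ.* ∣ + b * + b ∣   ≡⟨ cong₂ ℕ._*_ (ℤ.abs-* (+ a) (+ a)) (ℤ.abs-* (+ b) (+ b)) ⟩
    a ℕ.* a ℕ.* (b ℕ.* b)             ∎
  lem₂ : ∀ c → - (+ 3 * (+ 4 * c)) * - (+ 3 * (+ 4 * c)) ≡ + 4 * ((+ 2 * (+ 3 * c)) * (+ 2 * (+ 3 * c)))
  lem₂ = solve-∀
  cross² : ∀ u v l c → ⟨ l + + 2 * c , + 4 * c ⟩ ≡ u ⊗ v → + a + + b ≡ + 3 * c →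
    cross (√-3 ⊗ u) (√-3 ⊗ conj v) * cross (√-3 ⊗ u) (√-3 ⊗ conj v) ≡
    + 4 * ((+ 2 * (+ a + + b)) * (+ 2 * (+ a + + b)))
  cross² u v l c z≡uv a+b≡3c = begin
    cross (√-3 ⊗ u) (√-3 ⊗ conj v) * cross (√-3 ⊗ u) (√-3 ⊗ conj v)
      ≡⟨ cong (λ i → i * i) (trans (cross-scaled u v) (cong (λ t → - (+ 3 * 𝔼.ω-coeff t)) (sym z≡uv))) ⟩
    - (+ 3 * (+ 4 * c)) * - (+ 3 * (+ 4 * c))       ≡⟨ lem₂ c ⟩
    + 4 * ((+ 2 * (+ 3 * c)) * (+ 2 * (+ 3 * c)))
      ≡⟨ cong (λ i → + 4 * ((+ 2 * i) * (+ 2 * i))) a+b≡3c ⟨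
    + 4 * ((+ 2 * (+ a + + b)) * (+ 2 * (+ a + + b))) ∎

+[2*[a+b]] : ∀ a b → + (2 ℕ.* (a ℕ.+ b)) ≡ + 2 * (+ a + + b)
+[2*[a+b]] a b = trans (ℤ.pos-* 2 (a ℕ.+ b)) (cong (+ 2 *_) (ℤ.pos-+ a b))

disc-^ : ∀ a b k → + 9 * a ^ 2 * b ^ 2 - + 12 * (a + b) ^ 2 ≡ k ^ 2 ⇔ disc a b ≡ k * k
disc-^ a b k = mk⇔ (subst₂ _≡_ eq (i^2 k)) (subst₂ _≡_ (sym eq) (sym (i^2 k)))
  where
  i^2 : ∀ i → i ^ 2 ≡ i * i
  i^2 i = cong (i *_) (ℤ.*-identityʳ i)
  eq : + 9 * a ^ 2 * b ^ 2 - + 12 * (a + b) ^ 2 ≡ disc a b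
  eq = cong₂ (λ i j → i - + 12 * j) (cong₂ (λ i j → + 9 * i * j) (i^2 a) (i^2 b)) (i^2 (a + b))

-- The two implications

-- No vertex need be the origin, so the lattice vectors are the differences B - A and D - A; the
-- second gets its length from BC through `AD≈BC`.
ELEP⇒square : ∀ a b P → IsELEP P → HasSideLengths P (fromℤ (+ a) *ᴿ √3) (fromℤ (+ b) *ᴿ √3) →
  ∃[ k ] disc (+ a) (+ b) ≡ k * k
ELEP⇒square a b P (equable , A∈ , B∈ , C∈ , D∈) sides@(AB≃ , BC≃) =
  let t , A≈ = ∈⇒lattice A∈
      s , B≈ = ∈⇒lattice B∈
      r , D≈ = ∈⇒lattice D∈
  in go (s ⊕ ⊝ t) (r ⊕ ⊝ t) (lattice-vector {B} {A} s t B≈ A≈) (lattice-vector {D} {A} r t D≈ A≈)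
  where
  open Parallelogram P
  go : ∀ u v → B -ᶜ A ≈ᶜ lattice u → D -ᶜ A ≈ᶜ lattice v → ∃[ k ] disc (+ a) (+ b) ≡ k * k
  go u v AB≈u AD≈v = lattice⇒square u v (+ a) (+ b)
    (length⇒norm {B -ᶜ A} {u} a AB≈u [ AB≃ ])
    (length⇒norm {C -ᶜ B} {v} b
      (≈ᶜ-trans {C -ᶜ B} {D -ᶜ A} {lattice v} (≈ᶜ-sym {D -ᶜ A} {C -ᶜ B} (AD≈BC P)) AD≈v) [ BC≃ ])
    (subst (λ n → cross u v * cross u v ≡ + 4 * (n * n)) (+[2*[a+b]] a b)
      (equable⇒cross² P a b u v AB≈u AD≈v sides equable))

square⇒ELEP : ∀ a b .{{_ : NonZero a}} k → disc (+ a) (+ b) ≡ k * k →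
  ∃[ P ] (IsELEP P × HasSideLengths P (fromℤ (+ a) *ᴿ √3) (fromℤ (+ b) *ᴿ √3))
square⇒ELEP a b k disc≡k² =
  let u , v , norm-u , norm-v , δ² = square⇒lattice a b k disc≡k² in build u v norm-u norm-v δ²
  where
  -- The squared cross product will be 16 (a + b)², so this provides nondegeneracy.
  sum≢0 : + 4 * ((+ 2 * (+ a + + b)) * (+ 2 * (+ a + + b))) ≢ 0ℤ
  sum≢0 eq = ℕ.≢-nonZero⁻¹ (a ℕ.+ b) {{ℕ.>-nonZero (ℕ.<-≤-trans (ℕ.>-nonZero⁻¹ a) (ℕ.m≤m+n a b))}}
    (ℤ.+-injective (trans (ℤ.pos-+ a b) (root (+ a + + b) eq)))
    where
    zero-square : ∀ i → i * i ≡ 0ℤ → i ≡ 0ℤ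
    zero-square i i²≡0 = reduce (ℤ.i*j≡0⇒i≡0∨j≡0 i i²≡0)
    root : ∀ i → + 4 * ((+ 2 * i) * (+ 2 * i)) ≡ 0ℤ → i ≡ 0ℤ
    root i eq = ℤ.*-cancelˡ-≡ (+ 2) i 0ℤ
      (zero-square (+ 2 * i) (ℤ.*-cancelˡ-≡ (+ 4) ((+ 2 * i) * (+ 2 * i)) 0ℤ eq))

  build : ∀ u v → norm u ≡ + 3 * (+ a * + a) → norm v ≡ + 3 * (+ b * + b) →
    cross u v * cross u v ≡ + 4 * ((+ 2 * (+ a + + b)) * (+ 2 * (+ a + + b))) →
    ∃[ P ] (IsELEP P × HasSideLengths P (fromℤ (+ a) *ᴿ √3) (fromℤ (+ b) *ᴿ √3))
  build u v norm-u norm-v δ² = P ,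
    (cross²⇒equable P a b u v AB≈u AD≈v sides
      (subst (λ n → cross u v * cross u v ≡ + 4 * (n * n)) (sym (+[2*[a+b]] a b)) δ²) ,
     lattice-∈ 0ᴱ , lattice-∈ u , lattice-∈ (u ⊕ v) , lattice-∈ v) ,
    sides
    where
    P : Parallelogram
    P = lattice-parallelogram u v (λ δ²≡0 → sum≢0 (trans (sym δ²) δ²≡0))
    open Parallelogram P
    AB≈u : B -ᶜ A ≈ᶜ lattice u
    AB≈u = from-origin u
    AD≈v : D -ᶜ A ≈ᶜ lattice v
    AD≈v = from-origin v
    sides : HasSideLengths P (fromℤ (+ a) *ᴿ √3) (fromℤ (+ b) *ᴿ √3)
    sides = ≈⇒≃ (norm⇒length {B -ᶜ A} {u} a AB≈u norm-u) ,
            ≈⇒≃ (norm⇒length {C -ᶜ B} {v} b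
              (≈ᶜ-trans {C -ᶜ B} {D -ᶜ A} {lattice v} (≈ᶜ-sym {D -ᶜ A} {C -ᶜ B} (AD≈BC P)) AD≈v) norm-v)

theorem1 : (a b : ℕ) .{{_ : NonZero a}} .{{_ : NonZero b}} →
    (∃[ P ] (IsELEP P × HasSideLengths P (fromℤ (+ a) *ᴿ √3) (fromℤ (+ b) *ᴿ √3)))
    ⇔
    (∃[ k ] (+ 9 * (+ a) ^ 2 * (+ b) ^ 2 - + 12 * (+ a + + b) ^ 2 ≡ k ^ 2))
theorem1 a b = mk⇔
  (λ (P , elep , sides) → let k , eq = ELEP⇒square a b P elep sides in
    k , Equivalence.from (disc-^ (+ a) (+ b) k) eq)
  (λ (k , eq) → square⇒ELEP a b k (Equivalence.to (disc-^ (+ a) (+ b) k) eq))
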